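{- Let $n>1$ be an integer, let $\omega\in\mathbb{F}_{2^{2n}}\setminus\mathbb{F}_{2^n}$, and let $b\in\mathbb{F}_{2^{3n}}^*$ with $N_{2^{3n}/2^n}(b)\neq 1$ and such that $$x+bx^{2^{2n+1}-1}\notin\mathbb{F}_{2^n}\quad\text{for every } x\in\mathbb{F}_{2^{3n}}^*.$$ Then $$L_U=\{\langle x^2+bx^{2^{2n+1}}+x\omega\rangle_{\mathbb{F}_{2^{2n}}} : x\in\mathbb{F}_{2^{3n}}^*\},\qquad U=\{x^2+bx^{2^{2n+1}}+x\omega: x\in\mathbb{F}_{2^{3n}}\},$$ is a scattered $\mathbb{F}_2$-linear set of rank $3n$ of the projective plane $PG(2,2^{2n})=PG(\mathbb{F}_{2^{6n}},\mathbb{F}_{2^{2n}})$.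
   Context: $N_{2^{3n}/2^n}$ denotes the norm map from $\mathbb{F}_{2^{3n}}$ to $\mathbb{F}_{2^n}$. $\mathbb{F}_{2^{6n}}$ is regarded as a $3$-dimensional vector space over $\mathbb{F}_{2^{2n}}$. For an $\mathbb{F}_2$-subspace $U$ of $\mathbb{F}_{2^{6n}}$ of $\mathbb{F}_2$-dimension $k$, $L_U=\{\langle u\rangle_{\mathbb{F}_{2^{2n}}}: u\in U\setminus\{0\}\}$ is an $\mathbb{F}_2$-linear set of rank $k$; it is scattered if every point $\langle v\rangle$ of $L_U$ satisfies $\dim_{\mathbb{F}_2}(U\cap\langle v\rangle_{\mathbb{F}_{2^{2n}}})=1$. -}

module Defs where

open import Level using (Level; _⊔_)
open import Data.Nat using (ℕ; zero; suc) renaming (_+_ to _+ℕ_; _*_ to _*ℕ_; _^_ to _^ℕ_)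
open import Data.Fin using (Fin)
open import Data.Bool using (Bool; true; false; if_then_else_)
open import Data.Product using (Σ; _×_; _,_)
open import Relation.Nullary using (¬_)
open import Relation.Binary.PropositionalEquality as P using (_≡_)
open import Algebra.Bundles using (CommutativeRing)
open import Function.Bundles using (Inverse)

record IsFieldCR {c ℓ : Level} (R : CommutativeRing c ℓ) : Set (c ⊔ ℓ) where
  open CommutativeRing R
  field
    0≉1     : ¬ (0# ≈ 1#)
    inverse : ∀ x → ¬ (x ≈ 0#) → Σ Carrier (λ y → x * y ≈ 1#)

HasCardinality : {c ℓ : Level} → CommutativeRing c ℓ → ℕ → Set (c ⊔ ℓ)
HasCardinality R m = Inverse (CommutativeRing.setoid R) (P.setoid (Fin m))

module FieldNotions {c ℓ : Level} (F : CommutativeRing c ℓ) where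
  open CommutativeRing F

  pow : Carrier → ℕ → Carrier
  pow x zero    = 1#
  pow x (suc k) = x * pow x k

  -- membership in the subfield F_{2^k} = { x : x^(2^k) = x }
  InSub : ℕ → Carrier → Set ℓ
  InSub k x = pow x (2 ^ℕ k) ≈ x

  InSub* : ℕ → Carrier → Set ℓ
  InSub* k x = InSub k x × ¬ (x ≈ 0#)

  -- norm from F_{2^{3n}} to F_{2^n}: b ↦ b^(1 + 2^n + 2^{2n})
  norm3 : ℕ → Carrier → Carrier
  norm3 n b = pow b (1 +ℕ 2 ^ℕ n +ℕ 2 ^ℕ (2 *ℕ n))

  comb : {d : ℕ} → (Fin d → Carrier) → (Fin d → Bool) → Carrier
  comb {zero}  e c = 0#
  comb {suc d} e c =
    (if c Fin.zero then e Fin.zero else 0#) + comb (λ i → e (Fin.suc i)) (λ i → c (Fin.suc i))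
    where import Data.Fin as Fin

  HasF2Dim : {p : Level} → (Carrier → Set p) → ℕ → Set (c ⊔ ℓ ⊔ p)
  HasF2Dim S d =
    Σ (Fin d → Carrier) λ e →
        (∀ (k : Fin d → Bool) → S (comb e k))
      × (∀ y → S y → Σ (Fin d → Bool) λ k → y ≈ comb e k)
      × (∀ (k : Fin d → Bool) → comb e k ≈ 0# → ∀ i → k i ≡ false)

  -- U : an F_2-subspace of F = F_{2^{6n}}, viewed in PG(F_{2^{6n}}, F_{2^{2n}}).
  -- L_U is a scattered F_2-linear set of rank r:
  --   dim_{F_2} U = r, and for every point ⟨v⟩ (v ∈ U∖{0}),
  --   dim_{F_2} (U ∩ ⟨v⟩_{F_{2^{2n}}}) = 1.
  ScatteredOfRank : {p : Level} → ℕ → (Carrier → Set p) → ℕ → Set (c ⊔ ℓ ⊔ p)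
  ScatteredOfRank n U r =
      HasF2Dim U r
    × (∀ v → U v → ¬ (v ≈ 0#) →
         HasF2Dim (λ y → U y × Σ Carrier (λ λ' → InSub (2 *ℕ n) λ' × y ≈ λ' * v)) 1)

{-# OPTIONS --safe #-}

-- Write q = 2ⁿ, x ↦ x′ for the q-Frobenius, K = F_{q³} and f z = z² + b z″².  As ω ∈ F_{q²} ∖ F_q, every
-- element of F_{q⁶} is uniquely u + v ω with u, v ∈ K.  Hence |K|² = 2⁶ⁿ, and x ↦ f x + x ω is injective on K,
-- so that U has dimension 3n.
--
-- Suppose f x + x ω = λ (f y + y ω) with λ ∈ F_{q²}.  If λ ∈ F_q then x = λ y and
-- f x = λ f y, whereas f (λ y) = λ² f y; so λ² = λ.
-- Otherwise comparing coordinates and applying f shows that f maps the F_q-plane spanned by y and f y to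
-- itself, f (f y) = δ f y + ε y with ε ≠ 0.  Since 1 + N(b) ≠ 0, a multiple a ≠ 0 of the cross product of
-- (y, y′, y″) and its image under f then satisfies a + b′ a′ = a², i.e. φ z = Tr (a z) has φ (f z) = φ(z)².
-- The hypothesis says that no z ≠ 0 in K has f z ∈ F_q z; in particular g z = f z + z is injective on the
-- finite set K.  So w = a⁻¹ recurs under g, but φ w = 1 while φ (g z) = φ(z)² + φ(z) forces φ to vanish on
-- all later iterates of w.

module Submission where

open import Defs
open import Level using (Level; _⊔_)
open import Data.Nat using (ℕ; zero; suc; _<_; _≤_; _∸_) renaming (_+_ to _+ℕ_; _*_ to _*ℕ_; _^_ to _^ℕ_)
import Data.Nat.Properties as ℕ
open import Data.Nat.GeneralisedArithmetic using (fold)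
open import Data.Nat.Tactic.RingSolver using (solve-∀)
open import Data.Bool using (Bool; true; false; _xor_; _∧_)
open import Data.Fin as Fin using (Fin)
import Data.Fin.Properties as Fin
open import Data.Fin.Permutation using (Permutation′; permutation)
open import Data.Vec.Functional using (replicate)
open import Data.Maybe using (Maybe; just; nothing)
open import Data.Product using (Σ; ∃; _×_; _,_; proj₁; proj₂)
open import Data.Sum using (_⊎_; inj₁; inj₂)
open import Function.Base using (_∘_)
open import Function.Bundles using (Inverse)
open import Relation.Nullary using (¬_; Dec; yes; no; contradiction)
open import Relation.Nullary.Decidable using (map′; _×-dec_; ¬?)
open import Relation.Binary.PropositionalEquality as ≡ using (_≡_)
open import Algebra.Bundles using (CommutativeRing; RawRing)
import Algebra.Properties.Group
import Algebra.Properties.Ring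
import Algebra.Properties.CommutativeMonoid.Sum
import Algebra.Properties.CommutativeSemiring.Exp
import Algebra.Solver.Ring
open import Algebra.Solver.Ring.AlmostCommutativeRing using (fromCommutativeSemiring; _-Raw-AlmostCommutative⟶_)
import Relation.Binary.Reasoning.Setoid

HasCharTwo : {c ℓ : Level} → CommutativeRing c ℓ → Set ℓ
HasCharTwo R = let open CommutativeRing R in 1# + 1# ≈ 0#

-- Finite carriers: decidable equality and recurrence of injective maps.

module FiniteSetoid {c ℓ : Level} (F : CommutativeRing c ℓ) {N : ℕ} (card : HasCardinality F N) where
  open CommutativeRing F
  open Inverse card using (to; from; to-cong; strictlyInverseʳ)

  to-injective : ∀ {x y} → to x ≡ to y → x ≈ y
  to-injective {x} {y} eq =
    trans (sym (strictlyInverseʳ x)) (trans (reflexive (≡.cong from eq)) (strictlyInverseʳ y))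

  infix 4 _≟_
  _≟_ : ∀ x y → Dec (x ≈ y)
  x ≟ y = map′ to-injective to-cong (to x Fin.≟ to y)

  module _ {p} (K : Carrier → Set p) (g : Carrier → Carrier)
           (g-closed : ∀ {x} → K x → K (g x)) where

    fold-closed : ∀ k {x} → K x → K (fold x g k)
    fold-closed zero    Kx = Kx
    fold-closed (suc k) Kx = g-closed (fold-closed k Kx)

    module _ (g-injective : ∀ {x y} → K x → K y → g x ≈ g y → x ≈ y) where

      fold-cancel : ∀ i j {x} → K x → i < j → fold x g i ≈ fold x g j → ∃ λ m → x ≈ fold x g (suc m)
      fold-cancel zero    (suc j) Kx _   eq = j , eq
      fold-cancel (suc i) (suc j) Kx i<j eq =
        fold-cancel i j Kx (ℕ.≤-pred i<j) (g-injective (fold-closed i Kx) (fold-closed j Kx) eq)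

      -- The first N + 1 iterates lie in a carrier of size N, so two coincide; `fold-cancel` strips
      -- the common applications of `g`.
      injective⇒periodic : ∀ {x} → K x → ∃ λ m → x ≈ fold x g (suc m)
      injective⇒periodic {x} Kx
        with i , j , i<j , eq ← Fin.pigeonhole (ℕ.n<1+n N) (λ k → to (fold x g (Fin.toℕ k)))
        = fold-cancel (Fin.toℕ i) (Fin.toℕ j) Kx i<j (to-injective eq)

-- Cancellation in fields and ring endomorphisms.

module FieldLemmas {c ℓ : Level} (F : CommutativeRing c ℓ) (field′ : IsFieldCR F) where
  open CommutativeRing F
  open IsFieldCR field′
  open Relation.Binary.Reasoning.Setoid setoid

  *-cancelˡ-≉0 : ∀ {x y z} → ¬ (x ≈ 0#) → x * y ≈ x * z → y ≈ z
  *-cancelˡ-≉0 {x} {y} {z} x≉0 eq with x⁻¹ , xx⁻¹≈1 ← inverse x x≉0 = begin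
    y               ≈⟨ lemma y ⟩
    x⁻¹ * (x * y)   ≈⟨ *-congˡ eq ⟩
    x⁻¹ * (x * z)   ≈⟨ lemma z ⟨
    z               ∎
    where
    lemma : ∀ t → t ≈ x⁻¹ * (x * t)
    lemma t = begin
      t              ≈⟨ *-identityˡ t ⟨
      1# * t         ≈⟨ *-congʳ xx⁻¹≈1 ⟨
      x * x⁻¹ * t    ≈⟨ *-congʳ (*-comm x x⁻¹) ⟩
      x⁻¹ * x * t    ≈⟨ *-assoc x⁻¹ x t ⟩
      x⁻¹ * (x * t)  ∎

  x*y≈0⇒y≈0 : ∀ {x y} → ¬ (x ≈ 0#) → x * y ≈ 0# → y ≈ 0#
  x*y≈0⇒y≈0 {x} x≉0 eq = *-cancelˡ-≉0 x≉0 (trans eq (sym (zeroʳ x)))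

  *-≉0 : ∀ {x y} → ¬ (x ≈ 0#) → ¬ (y ≈ 0#) → ¬ (x * y ≈ 0#)
  *-≉0 x≉0 y≉0 eq = y≉0 (x*y≈0⇒y≈0 x≉0 eq)

record IsEndo {c ℓ : Level} (F : CommutativeRing c ℓ) (τ : CommutativeRing.Carrier F → CommutativeRing.Carrier F)
  : Set (c ⊔ ℓ) where
  open CommutativeRing F
  field
    τ-cong : ∀ {x y} → x ≈ y → τ x ≈ τ y
    +-homo : ∀ x y → τ (x + y) ≈ τ x + τ y
    *-homo : ∀ x y → τ (x * y) ≈ τ x * τ y
    1-homo : τ 1# ≈ 1#

module _ {c ℓ : Level} (F : CommutativeRing c ℓ) where
  open CommutativeRing F

  endo-∘ : ∀ {τ υ} → IsEndo F τ → IsEndo F υ → IsEndo F (λ x → τ (υ x))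
  endo-∘ T U = record
    { τ-cong = λ eq → T.τ-cong (U.τ-cong eq)
    ; +-homo = λ x y → trans (T.τ-cong (U.+-homo x y)) (T.+-homo _ _)
    ; *-homo = λ x y → trans (T.τ-cong (U.*-homo x y)) (T.*-homo _ _)
    ; 1-homo = trans (T.τ-cong U.1-homo) T.1-homo
    }
    where
    module T = IsEndo T
    module U = IsEndo U

-- Arithmetic in characteristic two.

module CharTwo {c ℓ : Level} (F : CommutativeRing c ℓ)
  (1+1≈0 : HasCharTwo F) where
  open CommutativeRing F
  open Relation.Binary.Reasoning.Setoid setoid

  private
    𝔽₂ : RawRing _ _
    𝔽₂ = record { Carrier = Bool ; _≈_ = _≡_ ; _+_ = _xor_ ; _*_ = _∧_ ; -_ = λ x → x ; 0# = false ; 1# = true }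

    ⟦_⟧₂ : Bool → Carrier
    ⟦ true  ⟧₂ = 1#
    ⟦ false ⟧₂ = 0#

    ⟦⟧₂-+ : ∀ x y → ⟦ x xor y ⟧₂ ≈ ⟦ x ⟧₂ + ⟦ y ⟧₂
    ⟦⟧₂-+ true  true  = sym 1+1≈0
    ⟦⟧₂-+ true  false = sym (+-identityʳ 1#)
    ⟦⟧₂-+ false y     = sym (+-identityˡ _)

    ⟦⟧₂-* : ∀ x y → ⟦ x ∧ y ⟧₂ ≈ ⟦ x ⟧₂ * ⟦ y ⟧₂
    ⟦⟧₂-* true  y = sym (*-identityˡ _)
    ⟦⟧₂-* false y = sym (zeroˡ _)

    morphism : 𝔽₂ -Raw-AlmostCommutative⟶ fromCommutativeSemiring commutativeSemiring
    morphism = record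
      { ⟦_⟧ = ⟦_⟧₂ ; +-homo = ⟦⟧₂-+ ; *-homo = ⟦⟧₂-* ; -‿homo = λ _ → refl ; 0-homo = refl ; 1-homo = refl }

    _≟₂_ : ∀ x y → Maybe (⟦ x ⟧₂ ≈ ⟦ y ⟧₂)
    true  ≟₂ true  = just refl
    false ≟₂ false = just refl
    _     ≟₂ _     = nothing

  -- With coefficients in F₂ the solver also knows that x + x ≈ 0.
  open Algebra.Solver.Ring 𝔽₂ (fromCommutativeSemiring commutativeSemiring) morphism _≟₂_ public
    using (solve; _:=_; _:+_; _:*_; con)

  x+x≈0 : ∀ x → x + x ≈ 0#
  x+x≈0 = solve 1 (λ x → x :+ x := con false) refl

  x+y≈0⇒x≈y : ∀ {x y} → x + y ≈ 0# → x ≈ y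
  x+y≈0⇒x≈y {x} {y} eq = begin
    x            ≈⟨ solve 2 (λ x y → x := (x :+ y) :+ y) refl x y ⟩
    (x + y) + y  ≈⟨ +-congʳ eq ⟩
    0# + y       ≈⟨ +-identityˡ y ⟩
    y            ∎

  x≈y⇒x+y≈0 : ∀ {x y} → x ≈ y → x + y ≈ 0#
  x≈y⇒x+y≈0 {x} {y} eq = trans (+-congʳ eq) (x+x≈0 y)

  -- Here a is the first coordinate of y × A.  With M the matrix for which A = M y² (squares taken entrywise),
  -- ε (y × A) = A × M A² = M y² × M A² is the cofactor matrix of M applied to (y × A)², and Mᵀ times that
  -- matrix is the scalar det M = 1 + b₀ b₁ b₂.
  cross-product-identity : ∀ y₀ y₁ y₂ b₀ b₁ b₂ A₀ A₁ A₂ δ ε →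
    A₀ ≈ y₀ * y₀ + b₀ * (y₂ * y₂) →
    A₁ ≈ y₁ * y₁ + b₁ * (y₀ * y₀) →
    A₂ ≈ y₂ * y₂ + b₂ * (y₁ * y₁) →
    A₀ * A₀ + b₀ * (A₂ * A₂) ≈ δ * A₀ + ε * y₀ →
    A₁ * A₁ + b₁ * (A₀ * A₀) ≈ δ * A₁ + ε * y₁ →
    A₂ * A₂ + b₂ * (A₁ * A₁) ≈ δ * A₂ + ε * y₂ →
    let a = y₁ * A₂ + y₂ * A₁ in
    ε * (a + b₁ * (y₂ * A₀ + y₀ * A₂)) ≈ (1# + b₀ * b₁ * b₂) * (a * a)
  cross-product-identity y₀ y₁ y₂ b₀ b₁ b₂ A₀ A₁ A₂ δ ε A₀≈ A₁≈ A₂≈ e₀ e₁ e₂ = begin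
    ε * (y₁ * A₂ + y₂ * A₁ + b₁ * (y₂ * A₀ + y₀ * A₂))
      -- The δ-terms introduced here cancel in pairs; they make `e₀`, `e₁`, `e₂` applicable.
      ≈⟨ solve 9 (λ y₀ y₁ y₂ b₁ A₀ A₁ A₂ δ ε →
           ε :* (y₁ :* A₂ :+ y₂ :* A₁ :+ b₁ :* (y₂ :* A₀ :+ y₀ :* A₂)) :=
           (δ :* A₁ :+ ε :* y₁) :* A₂ :+ (δ :* A₂ :+ ε :* y₂) :* A₁
             :+ b₁ :* ((δ :* A₂ :+ ε :* y₂) :* A₀ :+ (δ :* A₀ :+ ε :* y₀) :* A₂))
           refl y₀ y₁ y₂ b₁ A₀ A₁ A₂ δ ε ⟩
    (δ * A₁ + ε * y₁) * A₂ + (δ * A₂ + ε * y₂) * A₁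
      + b₁ * ((δ * A₂ + ε * y₂) * A₀ + (δ * A₀ + ε * y₀) * A₂)
      ≈⟨ +-cong (+-cong (*-congʳ e₁) (*-congʳ e₂)) (*-congˡ (+-cong (*-congʳ e₂) (*-congʳ e₀))) ⟨
    (A₁ * A₁ + b₁ * (A₀ * A₀)) * A₂ + (A₂ * A₂ + b₂ * (A₁ * A₁)) * A₁
      + b₁ * ((A₂ * A₂ + b₂ * (A₁ * A₁)) * A₀ + (A₀ * A₀ + b₀ * (A₂ * A₂)) * A₂)
      ≈⟨ solve 6 (λ b₀ b₁ b₂ A₀ A₁ A₂ →
           (A₁ :* A₁ :+ b₁ :* (A₀ :* A₀)) :* A₂ :+ (A₂ :* A₂ :+ b₂ :* (A₁ :* A₁)) :* A₁
             :+ b₁ :* ((A₂ :* A₂ :+ b₂ :* (A₁ :* A₁)) :* A₀ :+ (A₀ :* A₀ :+ b₀ :* (A₂ :* A₂)) :* A₂) :=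
           A₁ :* A₁ :* (A₂ :+ b₂ :* A₁ :+ b₁ :* b₂ :* A₀) :+ A₂ :* A₂ :* (A₁ :+ b₁ :* A₀ :+ b₀ :* b₁ :* A₂))
           refl b₀ b₁ b₂ A₀ A₁ A₂ ⟩
    A₁ * A₁ * (A₂ + b₂ * A₁ + b₁ * b₂ * A₀) + A₂ * A₂ * (A₁ + b₁ * A₀ + b₀ * b₁ * A₂)
      -- Only the unsquared `A₀`, `A₁`, `A₂` are expanded; the coefficients of `A₁ * A₁` and
      -- `A₂ * A₂` then collapse to multiples of y₂² and y₁².
      ≈⟨ +-cong (*-congˡ (+-cong (+-cong A₂≈ (*-congˡ A₁≈)) (*-congˡ A₀≈)))
                (*-congˡ (+-cong (+-cong A₁≈ (*-congˡ A₀≈)) (*-congˡ A₂≈))) ⟩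
    A₁ * A₁ * (y₂ * y₂ + b₂ * (y₁ * y₁) + b₂ * (y₁ * y₁ + b₁ * (y₀ * y₀)) + b₁ * b₂ * (y₀ * y₀ + b₀ * (y₂ * y₂)))
      + A₂ * A₂ * (y₁ * y₁ + b₁ * (y₀ * y₀) + b₁ * (y₀ * y₀ + b₀ * (y₂ * y₂)) + b₀ * b₁ * (y₂ * y₂ + b₂ * (y₁ * y₁)))
      ≈⟨ solve 8 (λ y₀ y₁ y₂ b₀ b₁ b₂ A₁ A₂ →
           A₁ :* A₁ :* (y₂ :* y₂ :+ b₂ :* (y₁ :* y₁) :+ b₂ :* (y₁ :* y₁ :+ b₁ :* (y₀ :* y₀))
             :+ b₁ :* b₂ :* (y₀ :* y₀ :+ b₀ :* (y₂ :* y₂)))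
             :+ A₂ :* A₂ :* (y₁ :* y₁ :+ b₁ :* (y₀ :* y₀) :+ b₁ :* (y₀ :* y₀ :+ b₀ :* (y₂ :* y₂))
             :+ b₀ :* b₁ :* (y₂ :* y₂ :+ b₂ :* (y₁ :* y₁))) :=
           (con true :+ b₀ :* b₁ :* b₂) :* ((y₁ :* A₂ :+ y₂ :* A₁) :* (y₁ :* A₂ :+ y₂ :* A₁)))
           refl y₀ y₁ y₂ b₀ b₁ b₂ A₁ A₂ ⟩
    (1# + b₀ * b₁ * b₂) * ((y₁ * A₂ + y₂ * A₁) * (y₁ * A₂ + y₂ * A₁)) ∎

-- The subfield fixed by a ring endomorphism.

module FixedField {c ℓ : Level} (F : CommutativeRing c ℓ) (field′ : IsFieldCR F)
  (1+1≈0 : HasCharTwo F)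
  {τ : CommutativeRing.Carrier F → CommutativeRing.Carrier F} (endo : IsEndo F τ) where
  open CommutativeRing F
  open IsFieldCR field′
  open FieldLemmas F field′
  open IsEndo endo
  open Relation.Binary.Reasoning.Setoid setoid

  Fixed : Carrier → Set ℓ
  Fixed x = τ x ≈ x

  0-homo : τ 0# ≈ 0#
  0-homo = begin
    τ 0#         ≈⟨ τ-cong 1+1≈0 ⟨
    τ (1# + 1#)  ≈⟨ +-homo 1# 1# ⟩
    τ 1# + τ 1#  ≈⟨ +-cong 1-homo 1-homo ⟩
    1# + 1#      ≈⟨ 1+1≈0 ⟩
    0#           ∎

  fixed-+ : ∀ {x y} → Fixed x → Fixed y → Fixed (x + y)
  fixed-+ fx fy = trans (+-homo _ _) (+-cong fx fy)

  fixed-* : ∀ {x y} → Fixed x → Fixed y → Fixed (x * y)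
  fixed-* fx fy = trans (*-homo _ _) (*-cong fx fy)

  fixed-resp : ∀ {x y} → x ≈ y → Fixed x → Fixed y
  fixed-resp x≈y fx = trans (τ-cong (sym x≈y)) (trans fx x≈y)

  unit-≉0 : ∀ {x y} → x * y ≈ 1# → ¬ (x ≈ 0#)
  unit-≉0 {x} {y} xy≈1 x≈0 = 0≉1 (trans (sym (zeroˡ y)) (trans (*-congʳ (sym x≈0)) xy≈1))

  fixed-inverse : ∀ {x y} → x * y ≈ 1# → Fixed x → Fixed y
  fixed-inverse {x} {y} xy≈1 fx = *-cancelˡ-≉0 (unit-≉0 xy≈1) (begin
    x * τ y    ≈⟨ *-congʳ fx ⟨
    τ x * τ y  ≈⟨ *-homo x y ⟨
    τ (x * y)  ≈⟨ τ-cong xy≈1 ⟩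
    τ 1#       ≈⟨ 1-homo ⟩
    1#         ≈⟨ xy≈1 ⟨
    x * y      ∎)

-- σ plays the role of the q-Frobenius, so that its fixed field is F_q and that of σ³ is F_{q³}.
module Semilinear {c ℓ : Level} (F : CommutativeRing c ℓ) (field′ : IsFieldCR F)
  {N : ℕ} (card : HasCardinality F N)
  (1+1≈0 : HasCharTwo F)
  (σ : CommutativeRing.Carrier F → CommutativeRing.Carrier F) (endo : IsEndo F σ)
  (b : CommutativeRing.Carrier F) where
  open CommutativeRing F
  open IsFieldCR field′
  open FieldLemmas F field′
  open CharTwo F 1+1≈0
  open FiniteSetoid F card
  open Relation.Binary.Reasoning.Setoid setoid
  open IsEndo endo public

  σ² σ³ : Carrier → Carrier
  σ² x = σ (σ x)
  σ³ x = σ (σ² x)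

  endo³ : IsEndo F σ³
  endo³ = endo-∘ F endo (endo-∘ F endo endo)

  module 𝔽q  = FixedField F field′ 1+1≈0 endo
  module 𝔽q³ = FixedField F field′ 1+1≈0 endo³
  open 𝔽q  public using () renaming (Fixed to Fix)
  open 𝔽q³ public using () renaming (Fixed to Fix³)

  Fix⇒Fix³ : ∀ {x} → Fix x → Fix³ x
  Fix⇒Fix³ fx = trans (τ-cong (trans (τ-cong fx) fx)) fx

  σ-Fix³ : ∀ {x} → Fix³ x → Fix³ (σ x)
  σ-Fix³ = τ-cong

  σ-≉0 : ∀ {x} → Fix³ x → ¬ (x ≈ 0#) → ¬ (σ x ≈ 0#)
  σ-≉0 Kx x≉0 σx≈0 = x≉0 (trans (sym Kx) (trans (τ-cong (trans (τ-cong σx≈0) 𝔽q.0-homo)) 𝔽q.0-homo))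

  -- For σ the q-Frobenius, the second square is z to the power 2^(2n+1).
  f : Carrier → Carrier
  f z = z * z + b * (σ² z * σ² z)

  sq-cong : ∀ {x y} → x ≈ y → x * x ≈ y * y
  sq-cong eq = *-cong eq eq

  f-cong : ∀ {x y} → x ≈ y → f x ≈ f y
  f-cong eq = +-cong (sq-cong eq) (*-congˡ (sq-cong (τ-cong (τ-cong eq))))

  f-+ : ∀ x y → f (x + y) ≈ f x + f y
  f-+ x y = begin
    f (x + y)
      ≈⟨ +-congˡ (*-congˡ (sq-cong (trans (τ-cong (+-homo x y)) (+-homo _ _)))) ⟩
    (x + y) * (x + y) + b * ((σ² x + σ² y) * (σ² x + σ² y))
      ≈⟨ solve 5 (λ b x y x₂ y₂ → (x :+ y) :* (x :+ y) :+ b :* ((x₂ :+ y₂) :* (x₂ :+ y₂)) :=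
           (x :* x :+ b :* (x₂ :* x₂)) :+ (y :* y :+ b :* (y₂ :* y₂))) refl b x y (σ² x) (σ² y) ⟩
    f x + f y ∎

  -- An element of F_q is fixed by `σ²`, so only the squaring acts on it; this square later forces
  -- λ² = λ.
  f-semilinear : ∀ {κ} → Fix κ → ∀ z → f (κ * z) ≈ κ * κ * f z
  f-semilinear {κ} fκ z = begin
    f (κ * z)
      ≈⟨ +-congˡ (*-congˡ (sq-cong (trans (τ-cong (*-homo κ z)) (trans (*-homo _ _) (*-congʳ (trans (τ-cong fκ) fκ)))))) ⟩
    (κ * z) * (κ * z) + b * ((κ * σ² z) * (κ * σ² z))
      ≈⟨ solve 4 (λ b κ z z₂ → (κ :* z) :* (κ :* z) :+ b :* ((κ :* z₂) :* (κ :* z₂)) :=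
           κ :* κ :* (z :* z :+ b :* (z₂ :* z₂))) refl b κ z (σ² z) ⟩
    κ * κ * f z ∎

  f-0 : f 0# ≈ 0#
  f-0 = begin
    f 0#                         ≈⟨ f-cong (zeroʳ 0#) ⟨
    f (0# * 0#)                  ≈⟨ f-semilinear 𝔽q.0-homo 0# ⟩
    0# * 0# * f 0#               ≈⟨ *-congʳ (zeroʳ 0#) ⟩
    0# * f 0#                    ≈⟨ zeroˡ _ ⟩
    0#                           ∎

  -- Conjugation turns `σ² z` into `σ³ z`, which is `z` again on K.
  σ-f : ∀ {z} → Fix³ z → σ (f z) ≈ σ z * σ z + σ b * (z * z)
  σ-f {z} Kz = trans (+-homo _ _) (+-cong (*-homo z z)
    (trans (*-homo _ _) (*-congˡ (trans (*-homo _ _) (sq-cong Kz)))))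

  σ²-f : ∀ {z} → Fix³ z → σ² (f z) ≈ σ² z * σ² z + σ² b * (σ z * σ z)
  σ²-f {z} Kz = trans (τ-cong (σ-f Kz)) (trans (+-homo _ _) (+-cong (*-homo _ _)
    (trans (*-homo _ _) (*-congˡ (*-homo z z)))))

  -- Planes invariant under `f` and fixed points of its adjoint.

  module _ (Kb : Fix³ b) where

    f-Fix³ : ∀ {z} → Fix³ z → Fix³ (f z)
    f-Fix³ Kz = 𝔽q³.fixed-+ (𝔽q³.fixed-* Kz Kz) (𝔽q³.fixed-* Kb (𝔽q³.fixed-* K₂ K₂))
      where K₂ = σ-Fix³ (σ-Fix³ Kz)

    -- If a ≠ 0, injectivity of f + id on K brings a⁻¹ back under iteration, while the functional Tr
    -- (a z) is 1 at a⁻¹ and 0 at every later iterate.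
    no-adjoint-fixed-point : (∀ {z} → Fix³ z → f z ≈ z → z ≈ 0#) →
      ∀ {a} → Fix³ a → a + σ b * σ a ≈ a * a → a ≈ 0#
    no-adjoint-fixed-point f-fixfree {a} Ka a-eq with a ≟ 0#
    ... | yes a≈0 = a≈0
    ... | no  a≉0 with w , aw≈1 ← inverse a a≉0 = contradiction φw≈0 φw≉0
      where
      φ g : Carrier → Carrier
      -- On K this is the trace of a z down to F_q, expanded into conjugates.
      φ z = a * z + σ a * σ z + σ² a * σ² z
      g z = f z + z

      φ-cong : ∀ {x y} → x ≈ y → φ x ≈ φ y
      φ-cong eq = +-cong (+-cong (*-congˡ eq) (*-congˡ (τ-cong eq))) (*-congˡ (τ-cong (τ-cong eq)))

      φ-+ : ∀ x y → φ (x + y) ≈ φ x + φ y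
      φ-+ x y = begin
        φ (x + y)
          ≈⟨ +-cong (+-congˡ (*-congˡ (+-homo x y))) (*-congˡ (trans (τ-cong (+-homo x y)) (+-homo _ _))) ⟩
        a * (x + y) + σ a * (σ x + σ y) + σ² a * (σ² x + σ² y)
          ≈⟨ solve 9 (λ a₀ a₁ a₂ x₀ x₁ x₂ y₀ y₁ y₂ →
               a₀ :* (x₀ :+ y₀) :+ a₁ :* (x₁ :+ y₁) :+ a₂ :* (x₂ :+ y₂) :=
               (a₀ :* x₀ :+ a₁ :* x₁ :+ a₂ :* x₂) :+ (a₀ :* y₀ :+ a₁ :* y₁ :+ a₂ :* y₂))
               refl a (σ a) (σ² a) x (σ x) (σ² x) y (σ y) (σ² y) ⟩
        φ x + φ y ∎

      -- Conjugates of `a-eq`; the second one, `a-eq₂`, closes the cycle with σ³ a = a and σ³ b = b.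
      a-eq₁ : σ a + σ² b * σ² a ≈ σ a * σ a
      a-eq₁ = trans (sym (trans (+-homo _ _) (+-congˡ (*-homo _ _)))) (trans (τ-cong a-eq) (*-homo a a))

      a-eq₂ : σ² a + b * a ≈ σ² a * σ² a
      a-eq₂ = trans (sym (trans (+-homo _ _) (+-congˡ (trans (*-homo _ _) (*-cong Kb Ka)))))
        (trans (τ-cong a-eq₁) (*-homo _ _))

      -- Collected by the squared conjugates of `z`, the coefficients are the left sides of `a-eq`
      -- and its conjugates.
      φ-f : ∀ {z} → Fix³ z → φ (f z) ≈ φ z * φ z
      φ-f {z} Kz = begin
        φ (f z)
          ≈⟨ +-cong (+-congˡ (*-congˡ (σ-f Kz))) (*-congˡ (σ²-f Kz)) ⟩
        a * (z * z + b * (σ² z * σ² z)) + σ a * (σ z * σ z + σ b * (z * z)) + σ² a * (σ² z * σ² z + σ² b * (σ z * σ z))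
          ≈⟨ solve 9 (λ a₀ a₁ a₂ b₀ b₁ b₂ z₀ z₁ z₂ →
               a₀ :* (z₀ :* z₀ :+ b₀ :* (z₂ :* z₂)) :+ a₁ :* (z₁ :* z₁ :+ b₁ :* (z₀ :* z₀))
                 :+ a₂ :* (z₂ :* z₂ :+ b₂ :* (z₁ :* z₁)) :=
               (a₀ :+ b₁ :* a₁) :* (z₀ :* z₀) :+ (a₁ :+ b₂ :* a₂) :* (z₁ :* z₁) :+ (a₂ :+ b₀ :* a₀) :* (z₂ :* z₂))
               refl a (σ a) (σ² a) b (σ b) (σ² b) z (σ z) (σ² z) ⟩
        (a + σ b * σ a) * (z * z) + (σ a + σ² b * σ² a) * (σ z * σ z) + (σ² a + b * a) * (σ² z * σ² z)
          ≈⟨ +-cong (+-cong (*-congʳ a-eq) (*-congʳ a-eq₁)) (*-congʳ a-eq₂) ⟩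
        a * a * (z * z) + σ a * σ a * (σ z * σ z) + σ² a * σ² a * (σ² z * σ² z)
          ≈⟨ solve 6 (λ a₀ a₁ a₂ z₀ z₁ z₂ →
               a₀ :* a₀ :* (z₀ :* z₀) :+ a₁ :* a₁ :* (z₁ :* z₁) :+ a₂ :* a₂ :* (z₂ :* z₂) :=
               (a₀ :* z₀ :+ a₁ :* z₁ :+ a₂ :* z₂) :* (a₀ :* z₀ :+ a₁ :* z₁ :+ a₂ :* z₂))
               refl a (σ a) (σ² a) z (σ z) (σ² z) ⟩
        φ z * φ z ∎

      φ-g : ∀ {z} → Fix³ z → φ (g z) ≈ φ z * φ z + φ z
      φ-g {z} Kz = trans (φ-+ (f z) z) (+-congʳ (φ-f Kz))

      g-Fix³ : ∀ {z} → Fix³ z → Fix³ (g z)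
      g-Fix³ Kz = 𝔽q³.fixed-+ (f-Fix³ Kz) Kz

      -- In characteristic two, equal values of `g` make x + y a fixed point of `f`.
      g-injective : ∀ {x y} → Fix³ x → Fix³ y → g x ≈ g y → x ≈ y
      g-injective {x} {y} Kx Ky gx≈gy = x+y≈0⇒x≈y (f-fixfree (𝔽q³.fixed-+ Kx Ky) (x+y≈0⇒x≈y (begin
        f (x + y) + (x + y)    ≈⟨ +-congʳ (f-+ x y) ⟩
        f x + f y + (x + y)    ≈⟨ solve 4 (λ a b c d → (a :+ b) :+ (c :+ d) := (a :+ c) :+ (b :+ d)) refl (f x) (f y) x y ⟩
        g x + g y              ≈⟨ x≈y⇒x+y≈0 gx≈gy ⟩
        0#                     ∎)))

      Kw : Fix³ w
      Kw = 𝔽q³.fixed-inverse aw≈1 Ka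

      σ-aw : σ a * σ w ≈ 1#
      σ-aw = trans (sym (*-homo a w)) (trans (τ-cong aw≈1) 1-homo)

      φw≈1 : φ w ≈ 1#
      φw≈1 = begin
        φ w           ≈⟨ +-cong (+-cong aw≈1 σ-aw) (trans (sym (*-homo _ _)) (trans (τ-cong σ-aw) 1-homo)) ⟩
        1# + 1# + 1#  ≈⟨ trans (+-congʳ 1+1≈0) (+-identityˡ 1#) ⟩
        1#            ∎

      φw≉0 : ¬ (φ w ≈ 0#)
      φw≉0 eq = 0≉1 (trans (sym eq) φw≈1)

      -- The polynomial t² + t vanishes at 1 and at 0, so the value drops to 0 after one step and
      -- stays there. The index `suc m` leaves out `w` itself, where φ is 1.
      φ-iterate : ∀ m → φ (fold w g (suc m)) ≈ 0#
      φ-iterate zero = begin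
        φ (g w)          ≈⟨ φ-g Kw ⟩
        φ w * φ w + φ w  ≈⟨ +-cong (sq-cong φw≈1) φw≈1 ⟩
        1# * 1# + 1#     ≈⟨ solve 0 (con true :* con true :+ con true := con false) refl ⟩
        0#               ∎
      φ-iterate (suc m) = begin
        φ (g z)          ≈⟨ φ-g (fold-closed Fix³ g g-Fix³ (suc m) Kw) ⟩
        φ z * φ z + φ z  ≈⟨ +-cong (sq-cong (φ-iterate m)) (φ-iterate m) ⟩
        0# * 0# + 0#     ≈⟨ solve 0 (con false :* con false :+ con false := con false) refl ⟩
        0#               ∎
        where z = fold w g (suc m)

      φw≈0 : φ w ≈ 0#
      φw≈0 with m , w≈ ← injective⇒periodic Fix³ g g-Fix³ g-injective Kw = trans (φ-cong w≈) (φ-iterate m)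

    -- The first hypothesis is N(b) ≠ 1. The equation negated in the second says f z / z ∈ F_q, with
    -- denominators cleared.
    module _ (norm≉1 : ¬ (b * σ b * σ² b ≈ 1#))
             (no-eigenvector : ∀ {z} → Fix³ z → ¬ (z ≈ 0#) → ¬ (f z * σ z ≈ z * σ (f z))) where

      fixed⇒0 : ∀ {z} → Fix³ z → f z ≈ z → z ≈ 0#
      fixed⇒0 {z} Kz fz≈z with z ≟ 0#
      ... | yes z≈0 = z≈0
      ... | no  z≉0 = contradiction (*-cong fz≈z (τ-cong (sym fz≈z))) (no-eigenvector Kz z≉0)

      f-≉0 : ∀ {z} → Fix³ z → ¬ (z ≈ 0#) → ¬ (f z ≈ 0#)
      f-≉0 {z} Kz z≉0 fz≈0 = no-eigenvector Kz z≉0 (begin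
        f z * σ z    ≈⟨ *-congʳ fz≈0 ⟩
        0# * σ z     ≈⟨ zeroˡ _ ⟩
        0#           ≈⟨ zeroʳ _ ⟨
        z * 0#       ≈⟨ *-congˡ (trans (τ-cong fz≈0) 𝔽q.0-homo) ⟨
        z * σ (f z)  ∎)

      -- If f leaves the F_q-plane spanned by y and f y invariant, then the vector a₀ orthogonal to this
      -- plane is, up to scaling, fixed by the adjoint of f.
      no-invariant-plane : ∀ {y δ ε} → Fix³ y → ¬ (y ≈ 0#) → Fix δ → Fix ε → ¬ (ε ≈ 0#) →
                           ¬ (f (f y) ≈ δ * f y + ε * y)
      no-invariant-plane {y} {δ} {ε} Ky y≉0 Fδ Fε ε≉0 plane with ε⁻¹ , εε⁻¹≈1 ← inverse ε ε≉0 =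
        *-≉0 k≉0 a₀≉0 (no-adjoint-fixed-point fixed⇒0 Ka a-eq)
        where
        A₀ A₁ A₂ a₀ Δ k a : Carrier
        A₀ = f y
        A₁ = σ A₀
        A₂ = σ A₁
        -- First coordinate of the cross product of the conjugate vectors of `y` and `f y`; the
        -- other two are `σ a₀` and `σ² a₀`.
        a₀ = σ y * A₂ + σ² y * A₁
        Δ  = 1# + b * σ b * σ² b
        -- `cross` reads ε (a₀ + σ b σ a₀) = Δ a₀²; scaling `a₀` by Δ / ε normalises this to the
        -- adjoint equation `a-eq`.
        k  = Δ * ε⁻¹
        a  = k * a₀

        KA : Fix³ A₀
        KA = f-Fix³ Ky

        σ-plane : σ (f A₀) ≈ δ * A₁ + ε * σ y
        σ-plane = trans (τ-cong plane) (trans (+-homo _ _)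
          (+-cong (trans (*-homo _ _) (*-congʳ Fδ)) (trans (*-homo _ _) (*-congʳ Fε))))

        σ²-plane : σ² (f A₀) ≈ δ * A₂ + ε * σ² y
        σ²-plane = trans (τ-cong σ-plane) (trans (+-homo _ _)
          (+-cong (trans (*-homo _ _) (*-congʳ Fδ)) (trans (*-homo _ _) (*-congʳ Fε))))

        cross : ε * (a₀ + σ b * (σ² y * A₀ + y * A₂)) ≈ Δ * (a₀ * a₀)
        cross = cross-product-identity y (σ y) (σ² y) b (σ b) (σ² b) A₀ A₁ A₂ δ ε
          refl (σ-f Ky) (σ²-f Ky) plane (trans (sym (σ-f KA)) σ-plane) (trans (sym (σ²-f KA)) σ²-plane)

        σ-a₀ : σ a₀ ≈ σ² y * A₀ + y * A₂
        σ-a₀ = trans (+-homo _ _) (+-cong (trans (*-homo _ _) (*-congˡ KA)) (trans (*-homo _ _) (*-congʳ Ky)))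

        Ka₀ : Fix³ a₀
        Ka₀ = 𝔽q³.fixed-+ (𝔽q³.fixed-* (σ-Fix³ Ky) (σ-Fix³ (σ-Fix³ KA)))
                          (𝔽q³.fixed-* (σ-Fix³ (σ-Fix³ Ky)) (σ-Fix³ KA))

        -- `σ² a₀` is y σ (f y) + f y σ y, whose vanishing would put f y / y in F_q.
        a₀≉0 : ¬ (a₀ ≈ 0#)
        a₀≉0 a₀≈0 = no-eigenvector Ky y≉0 (x+y≈0⇒x≈y (begin
          A₀ * σ y + y * A₁          ≈⟨ +-cong (*-comm _ _) refl ⟩
          σ y * A₀ + y * A₁          ≈⟨ +-cong (*-cong σ³-σy KA) (*-cong Ky σ³-A₁) ⟨
          σ² (σ² y) * σ³ A₀ + σ³ y * σ² A₂
            ≈⟨ solve 4 (λ p q r s → p :* q :+ r :* s := r :* s :+ p :* q) refl _ _ _ _ ⟩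
          σ³ y * σ² A₂ + σ² (σ² y) * σ³ A₀
            ≈⟨ trans (τ-cong (trans (+-homo _ _) (+-cong (*-homo _ _) (*-homo _ _))))
                     (trans (+-homo _ _) (+-cong (*-homo _ _) (*-homo _ _))) ⟨
          σ² a₀                      ≈⟨ τ-cong (trans (τ-cong a₀≈0) 𝔽q.0-homo) ⟩
          σ 0#                       ≈⟨ 𝔽q.0-homo ⟩
          0#                         ∎))
          where
          σ³-σy : σ² (σ² y) ≈ σ y
          σ³-σy = σ-Fix³ Ky
          σ³-A₁ : σ² A₂ ≈ A₁
          σ³-A₁ = σ-Fix³ KA

        FΔ : Fix Δ
        FΔ = 𝔽q.fixed-+ 1-homo (begin
          σ (b * σ b * σ² b)     ≈⟨ trans (*-homo _ _) (*-congʳ (*-homo _ _)) ⟩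
          σ b * σ² b * σ³ b      ≈⟨ *-congˡ Kb ⟩
          σ b * σ² b * b         ≈⟨ solve 3 (λ p q r → q :* r :* p := p :* q :* r) refl b (σ b) (σ² b) ⟩
          b * σ b * σ² b         ∎)

        Δ≉0 : ¬ (Δ ≈ 0#)
        Δ≉0 Δ≈0 = norm≉1 (sym (x+y≈0⇒x≈y Δ≈0))

        ε⁻¹≉0 : ¬ (ε⁻¹ ≈ 0#)
        ε⁻¹≉0 = 𝔽q.unit-≉0 (trans (*-comm _ _) εε⁻¹≈1)

        k≉0 : ¬ (k ≈ 0#)
        k≉0 = *-≉0 Δ≉0 ε⁻¹≉0

        Fk : Fix k
        Fk = 𝔽q.fixed-* FΔ (𝔽q.fixed-inverse εε⁻¹≈1 Fε)

        Ka : Fix³ a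
        Ka = 𝔽q³.fixed-* (Fix⇒Fix³ Fk) Ka₀

        a-eq : a + σ b * σ a ≈ a * a
        a-eq = begin
          a + σ b * σ a
            ≈⟨ +-congˡ (*-congˡ (trans (*-homo _ _) (*-cong Fk σ-a₀))) ⟩
          k * a₀ + σ b * (k * (σ² y * A₀ + y * A₂))
            ≈⟨ solve 4 (λ k a₀ b₁ a₁ → k :* a₀ :+ b₁ :* (k :* a₁) := k :* (con true :* (a₀ :+ b₁ :* a₁))) refl _ _ _ _ ⟩
          k * (1# * (a₀ + σ b * (σ² y * A₀ + y * A₂)))
            ≈⟨ *-congˡ (*-congʳ εε⁻¹≈1) ⟨
          k * (ε * ε⁻¹ * (a₀ + σ b * (σ² y * A₀ + y * A₂)))
            ≈⟨ solve 4 (λ k ε e t → k :* (ε :* e :* t) := k :* e :* (ε :* t)) refl _ _ _ _ ⟩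
          k * ε⁻¹ * (ε * (a₀ + σ b * (σ² y * A₀ + y * A₂)))
            ≈⟨ *-congˡ cross ⟩
          k * ε⁻¹ * (Δ * (a₀ * a₀))
            ≈⟨ solve 4 (λ k Δ e a₀ → k :* e :* (Δ :* (a₀ :* a₀)) := k :* (Δ :* e) :* (a₀ :* a₀)) refl _ _ _ _ ⟩
          k * k * (a₀ * a₀)
            ≈⟨ solve 2 (λ k a₀ → k :* k :* (a₀ :* a₀) := k :* a₀ :* (k :* a₀)) refl _ _ ⟩
          a * a ∎

  -- Coordinates over K with respect to 1 and ω.

  module _ {ω : Carrier} (ω-Fix² : σ² ω ≈ ω) (ω-¬Fix : ¬ Fix ω) where

    ω+σω≉0 : ¬ (ω + σ ω ≈ 0#)
    ω+σω≉0 eq = ω-¬Fix (sym (x+y≈0⇒x≈y eq))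

    σ³ω≈σω : σ³ ω ≈ σ ω
    σ³ω≈σω = τ-cong ω-Fix²

    -- `σ³` fixes K and sends ω to `σ ω`; adding the relation to its image leaves v (ω + σ ω) = 0.
    coordinates-0 : ∀ {u v} → Fix³ u → Fix³ v → u + v * ω ≈ 0# → u ≈ 0# × v ≈ 0#
    coordinates-0 {u} {v} Ku Kv eq = u≈0 , v≈0
      where
      open IsEndo endo³ using () renaming (+-homo to +-homo³; *-homo to *-homo³; τ-cong to σ³-cong)
      eq³ : u + v * σ ω ≈ 0#
      eq³ = begin
        u + v * σ ω          ≈⟨ +-cong Ku (*-cong Kv σ³ω≈σω) ⟨
        σ³ u + σ³ v * σ³ ω   ≈⟨ trans (+-homo³ _ _) (+-congˡ (*-homo³ _ _)) ⟨
        σ³ (u + v * ω)       ≈⟨ σ³-cong eq ⟩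
        σ³ 0#                ≈⟨ 𝔽q³.0-homo ⟩
        0#                   ∎
      v≈0 : v ≈ 0#
      v≈0 = x*y≈0⇒y≈0 ω+σω≉0 (begin
        (ω + σ ω) * v
          ≈⟨ solve 4 (λ u v w w₁ → (w :+ w₁) :* v := (u :+ v :* w) :+ (u :+ v :* w₁)) refl u v ω (σ ω) ⟩
        (u + v * ω) + (u + v * σ ω)  ≈⟨ +-cong eq eq³ ⟩
        0# + 0#                      ≈⟨ +-identityʳ 0# ⟩
        0#                           ∎)
      u≈0 : u ≈ 0#
      u≈0 = begin
        u           ≈⟨ +-identityʳ u ⟨
        u + 0#      ≈⟨ +-congˡ (zeroˡ ω) ⟨
        u + 0# * ω  ≈⟨ +-congˡ (*-congʳ v≈0) ⟨
        u + v * ω   ≈⟨ eq ⟩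
        0#          ∎

    coordinates-unique : ∀ {u v u′ v′} → Fix³ u → Fix³ v → Fix³ u′ → Fix³ v′ →
                         u + v * ω ≈ u′ + v′ * ω → u ≈ u′ × v ≈ v′
    coordinates-unique {u} {v} {u′} {v′} Ku Kv Ku′ Kv′ eq
      with u+u′≈0 , v+v′≈0 ← coordinates-0 (𝔽q³.fixed-+ Ku Ku′) (𝔽q³.fixed-+ Kv Kv′) (begin
        (u + u′) + (v + v′) * ω
          ≈⟨ solve 5 (λ u v u′ v′ w → (u :+ u′) :+ (v :+ v′) :* w := (u :+ v :* w) :+ (u′ :+ v′ :* w)) refl u v u′ v′ ω ⟩
        (u + v * ω) + (u′ + v′ * ω)
          ≈⟨ x≈y⇒x+y≈0 eq ⟩
        0# ∎)
      = x+y≈0⇒x≈y u+u′≈0 , x+y≈0⇒x≈y v+v′≈0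

    -- If x = u + v ω, then x + σ³ x = v (ω + σ ω), which dictates `v`, and then u = x + v ω. Both
    -- lie in K because `σ³` is an involution.
    coordinates-exist : (∀ x → σ³ (σ³ x) ≈ x) →
      ∀ x → Σ Carrier λ u → Σ Carrier λ v → Fix³ u × Fix³ v × x ≈ u + v * ω
    coordinates-exist σ⁶≈id x with s⁻¹ , ss⁻¹≈1 ← inverse (ω + σ ω) ω+σω≉0 = x + v * ω , v , Ku , Kv , x≈
      where
      open IsEndo endo³ using () renaming (+-homo to +-homo³; *-homo to *-homo³; τ-cong to σ³-cong)
      v : Carrier
      v = (x + σ³ x) * s⁻¹
      Ks : Fix³ (ω + σ ω)
      Ks = trans (+-homo³ _ _) (trans (+-cong σ³ω≈σω (trans (τ-cong σ³ω≈σω) ω-Fix²)) (+-comm _ _))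
      Kv : Fix³ v
      Kv = 𝔽q³.fixed-* (trans (+-homo³ _ _) (trans (+-congˡ (σ⁶≈id x)) (+-comm _ _)))
                       (𝔽q³.fixed-inverse ss⁻¹≈1 Ks)
      x≈ : x ≈ (x + v * ω) + v * ω
      x≈ = solve 2 (λ x y → x := (x :+ y) :+ y) refl x (v * ω)
      Ku : Fix³ (x + v * ω)
      Ku = begin
        σ³ (x + v * ω)         ≈⟨ trans (+-homo³ _ _) (+-congˡ (trans (*-homo³ _ _) (*-cong Kv σ³ω≈σω))) ⟩
        σ³ x + v * σ ω
          -- The excess over x + v ω is a multiple of 1 + (ω + σ ω) s⁻¹, that is, of 1 + 1.
          ≈⟨ solve 5 (λ x x₃ s⁻¹ w w₁ →
               x₃ :+ (x :+ x₃) :* s⁻¹ :* w₁ :=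
               (x :+ (x :+ x₃) :* s⁻¹ :* w) :+ (x :+ x₃) :* (con true :+ (w :+ w₁) :* s⁻¹))
               refl x (σ³ x) s⁻¹ ω (σ ω) ⟩
        (x + v * ω) + (x + σ³ x) * (1# + (ω + σ ω) * s⁻¹)
          ≈⟨ +-congˡ (*-congˡ (trans (+-congˡ ss⁻¹≈1) 1+1≈0)) ⟩
        (x + v * ω) + (x + σ³ x) * 0#
          ≈⟨ trans (+-congˡ (zeroʳ _)) (+-identityʳ _) ⟩
        x + v * ω ∎

    -- Multipliers between elements of U.

    module _ (Kb : Fix³ b) (norm≉1 : ¬ (b * σ b * σ² b ≈ 1#))
             (no-eigenvector : ∀ {z} → Fix³ z → ¬ (z ≈ 0#) → ¬ (f z * σ z ≈ z * σ (f z))) where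

      -- The test on λ + σ λ decides whether λ ∈ F_q. If so, x = λ y and semilinearity give λ² = λ;
      -- if not, eliminating `x` and `f x` leaves an invariant plane.
      f-ω-scattered : ∀ {x y λ′} → Fix³ x → Fix³ y → ¬ (y ≈ 0#) → σ² λ′ ≈ λ′ →
        f x + x * ω ≈ λ′ * (f y + y * ω) → λ′ ≈ 0# ⊎ λ′ ≈ 1#
      f-ω-scattered {x} {y} {λ′} Kx Ky y≉0 Fλ eq with λ′ + σ λ′ ≟ 0# | λ′ ≟ 0#
      ... | _ | yes λ≈0 = inj₁ λ≈0
      ... | yes l≈0 | no λ≉0 = inj₂ (*-cancelˡ-≉0 (*-≉0 λ≉0 (f-≉0 Kb norm≉1 no-eigenvector Ky y≉0)) (begin
              λ′ * f y * λ′
                ≈⟨ solve 2 (λ l z → l :* z :* l := l :* l :* z) refl λ′ (f y) ⟩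
              λ′ * λ′ * f y
                ≈⟨ f-semilinear Fixλ y ⟨
              f (λ′ * y)
                ≈⟨ f-cong (proj₂ xy) ⟨
              f x
                ≈⟨ proj₁ xy ⟩
              λ′ * f y
                ≈⟨ *-identityʳ _ ⟨
              λ′ * f y * 1# ∎))
        where
        Fixλ : Fix λ′
        Fixλ = sym (x+y≈0⇒x≈y l≈0)
        Kλ : Fix³ λ′
        Kλ = Fix⇒Fix³ Fixλ
        xy : f x ≈ λ′ * f y × x ≈ λ′ * y
        xy = coordinates-unique (f-Fix³ Kb Kx) Kx (𝔽q³.fixed-* Kλ (f-Fix³ Kb Ky)) (𝔽q³.fixed-* Kλ Ky)
          (trans eq (solve 4 (λ l p y w → l :* (p :+ y :* w) := l :* p :+ l :* y :* w) refl λ′ (f y) y ω))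
      ... | no l≉0 | no _ with l⁻¹ , ll⁻¹≈1 ← inverse (λ′ + σ λ′) l≉0 =
        contradiction plane (no-invariant-plane Kb norm≉1 no-eigenvector Ky y≉0 Fδ Fε ε≉0)
        where
        open IsEndo endo³ using () renaming (+-homo to +-homo³; *-homo to *-homo³; τ-cong to σ³-cong)
        -- `s` and `p` are the trace and norm of ω over F_q; `l`, `m`, `k` are the traces of λ, λ ω
        -- and λ σ ω. `δ` and `ε` come from dividing `scaled-plane` by l².
        λ₁ s l m k p δ ε : Carrier
        λ₁ = σ λ′
        s = ω + σ ω
        l = λ′ + λ₁
        m = λ′ * ω + λ₁ * σ ω
        k = λ′ * σ ω + λ₁ * ω
        p = ω * σ ω
        δ = l⁻¹ * l⁻¹ * (s * k + m * m)
        ε = l⁻¹ * s * p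

        eq³ : f x + x * σ ω ≈ λ₁ * (f y + y * σ ω)
        eq³ = begin
          f x + x * σ ω            ≈⟨ +-cong (f-Fix³ Kb Kx) (*-cong Kx σ³ω≈σω) ⟨
          σ³ (f x) + σ³ x * σ³ ω   ≈⟨ trans (+-homo³ _ _) (+-congˡ (*-homo³ _ _)) ⟨
          σ³ (f x + x * ω)         ≈⟨ σ³-cong eq ⟩
          σ³ (λ′ * (f y + y * ω))  ≈⟨ trans (*-homo³ _ _) (*-congˡ (trans (+-homo³ _ _) (+-congˡ (*-homo³ _ _)))) ⟩
          σ³ λ′ * (σ³ (f y) + σ³ y * σ³ ω)
            ≈⟨ *-cong (τ-cong Fλ) (+-cong (f-Fix³ Kb Ky) (*-cong Ky σ³ω≈σω)) ⟩
          λ₁ * (f y + y * σ ω)     ∎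

        -- Adding `eq` to its conjugate `eq³` cancels `f x`.
        sx≈ : s * x ≈ l * f y + m * y
        sx≈ = begin
          s * x
            ≈⟨ solve 4 (λ w w₁ x z → (w :+ w₁) :* x := (z :+ x :* w) :+ (z :+ x :* w₁)) refl ω (σ ω) x (f x) ⟩
          (f x + x * ω) + (f x + x * σ ω)
            ≈⟨ +-cong eq eq³ ⟩
          λ′ * (f y + y * ω) + λ₁ * (f y + y * σ ω)
            ≈⟨ solve 6 (λ l l₁ w w₁ y z → l :* (z :+ y :* w) :+ l₁ :* (z :+ y :* w₁) :=
                 (l :+ l₁) :* z :+ (l :* w :+ l₁ :* w₁) :* y) refl λ′ λ₁ ω (σ ω) y (f y) ⟩
          l * f y + m * y ∎

        -- The weights `σ ω` on `eq` and `ω` on `eq³` cancel `x`.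
        sfx≈ : s * f x ≈ k * f y + l * p * y
        sfx≈ = begin
          s * f x
            ≈⟨ solve 4 (λ w w₁ x z → (w :+ w₁) :* z := w₁ :* (z :+ x :* w) :+ w :* (z :+ x :* w₁)) refl ω (σ ω) x (f x) ⟩
          σ ω * (f x + x * ω) + ω * (f x + x * σ ω)
            ≈⟨ +-cong (*-congˡ eq) (*-congˡ eq³) ⟩
          σ ω * (λ′ * (f y + y * ω)) + ω * (λ₁ * (f y + y * σ ω))
            ≈⟨ solve 6 (λ l l₁ w w₁ y z → w₁ :* (l :* (z :+ y :* w)) :+ w :* (l₁ :* (z :+ y :* w₁)) :=
                 (l :* w₁ :+ l₁ :* w) :* z :+ (l :+ l₁) :* (w :* w₁) :* y) refl λ′ λ₁ ω (σ ω) y (f y) ⟩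
          k * f y + l * p * y ∎

        -- `σ` swaps the two conjugates in each of these traces and in the norm `p`.
        Fl : Fix l
        Fl = trans (+-homo _ _) (trans (+-congˡ Fλ) (+-comm _ _))
        Fs : Fix s
        Fs = trans (+-homo _ _) (trans (+-congˡ ω-Fix²) (+-comm _ _))
        Fm : Fix m
        Fm = trans (+-homo _ _) (trans (+-cong (*-homo _ _) (trans (*-homo _ _) (*-cong Fλ ω-Fix²))) (+-comm _ _))
        Fk : Fix k
        Fk = trans (+-homo _ _) (trans (+-cong (trans (*-homo _ _) (*-congˡ ω-Fix²)) (trans (*-homo _ _) (*-congʳ Fλ)))
                                     (+-comm _ _))
        Fp : Fix p
        Fp = trans (*-homo _ _) (trans (*-congˡ ω-Fix²) (*-comm _ _))
        Fl⁻¹ : Fix l⁻¹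
        Fl⁻¹ = 𝔽q.fixed-inverse ll⁻¹≈1 Fl
        Fδ : Fix δ
        Fδ = 𝔽q.fixed-* (𝔽q.fixed-* Fl⁻¹ Fl⁻¹) (𝔽q.fixed-+ (𝔽q.fixed-* Fs Fk) (𝔽q.fixed-* Fm Fm))
        Fε : Fix ε
        Fε = 𝔽q.fixed-* (𝔽q.fixed-* Fl⁻¹ Fs) Fp

        ω≉0 : ¬ (ω ≈ 0#)
        ω≉0 ω≈0 = ω-¬Fix (trans (τ-cong ω≈0) (trans 𝔽q.0-homo (sym ω≈0)))
        σω≉0 : ¬ (σ ω ≈ 0#)
        σω≉0 σω≈0 = ω≉0 (trans (sym ω-Fix²) (trans (τ-cong σω≈0) 𝔽q.0-homo))

        ε≉0 : ¬ (ε ≈ 0#)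
        ε≉0 = *-≉0 (*-≉0 (𝔽q.unit-≉0 (trans (*-comm _ _) ll⁻¹≈1)) ω+σω≉0) (*-≉0 ω≉0 σω≉0)

        -- f applied to both sides of sx≈, with f x eliminated by sfx≈.
        scaled-plane : l * l * f (f y) ≈ (s * k + m * m) * f y + l * s * p * y
        scaled-plane = begin
          l * l * f (f y)
            -- Of the two inserted copies of m² f y, one completes f (l f y + m y) and the other
            -- survives in the coefficient of `f y`.
            ≈⟨ solve 2 (λ u v → u := (u :+ v) :+ v) refl _ (m * m * f y) ⟩
          l * l * f (f y) + m * m * f y + m * m * f y
            ≈⟨ +-congʳ (+-cong (f-semilinear Fl (f y)) (f-semilinear Fm y)) ⟨
          f (l * f y) + f (m * y) + m * m * f y
            ≈⟨ +-congʳ (f-+ _ _) ⟨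
          f (l * f y + m * y) + m * m * f y
            ≈⟨ +-congʳ (f-cong sx≈) ⟨
          f (s * x) + m * m * f y
            ≈⟨ +-congʳ (trans (f-semilinear Fs x) (*-assoc s s (f x))) ⟩
          s * (s * f x) + m * m * f y
            ≈⟨ +-congʳ (*-congˡ sfx≈) ⟩
          s * (k * f y + l * p * y) + m * m * f y
            ≈⟨ solve 7 (λ s k m l p y z → s :* (k :* z :+ l :* p :* y) :+ m :* m :* z :=
                 (s :* k :+ m :* m) :* z :+ l :* s :* p :* y) refl s k m l p y (f y) ⟩
          (s * k + m * m) * f y + l * s * p * y ∎

        plane : f (f y) ≈ δ * f y + ε * y
        plane = begin
          f (f y)
            ≈⟨ solve 1 (λ z → con true :* con true :* z := z) refl _ ⟨
          1# * 1# * f (f y)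
            ≈⟨ *-congʳ (sq-cong ll⁻¹≈1) ⟨
          l * l⁻¹ * (l * l⁻¹) * f (f y)
            ≈⟨ solve 3 (λ l l⁻¹ z → l :* l⁻¹ :* (l :* l⁻¹) :* z := l⁻¹ :* l⁻¹ :* (l :* l :* z)) refl l l⁻¹ (f (f y)) ⟩
          l⁻¹ * l⁻¹ * (l * l * f (f y))
            ≈⟨ *-congˡ scaled-plane ⟩
          l⁻¹ * l⁻¹ * ((s * k + m * m) * f y + l * s * p * y)
            ≈⟨ solve 7 (λ l l⁻¹ t z s p y → l⁻¹ :* l⁻¹ :* (t :* z :+ l :* s :* p :* y) :=
                 l⁻¹ :* l⁻¹ :* t :* z :+ (l :* l⁻¹) :* (l⁻¹ :* s :* p :* y)) refl l l⁻¹ (s * k + m * m) (f y) s p y ⟩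
          δ * f y + (l * l⁻¹) * (ε * y)
            ≈⟨ +-congˡ (trans (*-congʳ ll⁻¹≈1) (*-identityˡ _)) ⟩
          δ * f y + ε * y ∎

-- Powers and Fermat's theorem in a finite field.

module Power {c ℓ : Level} (F : CommutativeRing c ℓ) where
  open CommutativeRing F
  open FieldNotions F
  open Algebra.Properties.CommutativeSemiring.Exp commutativeSemiring public
    using (_^_; ^-congˡ; ^-congʳ; ^-assocʳ; ^-homo-*; ^-distrib-*)

  pow≡^ : ∀ x k → pow x k ≡ x ^ k
  pow≡^ x zero    = ≡.refl
  pow≡^ x (suc k) = ≡.cong (x *_) (pow≡^ x k)

  pow≈^ : ∀ x k → pow x k ≈ x ^ k
  pow≈^ x k = reflexive (pow≡^ x k)

  1^ : ∀ k → 1# ^ k ≈ 1#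
  1^ zero    = refl
  1^ (suc k) = trans (*-identityˡ _) (1^ k)

  x^2≈x*x : ∀ x → x ^ 2 ≈ x * x
  x^2≈x*x x = *-congˡ (*-identityʳ x)

module Fermat {c ℓ : Level} (F : CommutativeRing c ℓ) (field′ : IsFieldCR F)
  {N : ℕ} (card : HasCardinality F N) where
  open CommutativeRing F
  open IsFieldCR field′
  open FieldLemmas F field′
  open FiniteSetoid F card
  open Power F
  open Inverse card using (to; from; to-cong; strictlyInverseʳ; strictlyInverseˡ)
  open Algebra.Properties.CommutativeMonoid.Sum *-commutativeMonoid using ()
    renaming (sum to product; sum-remove to product-remove; ∑-distrib-+ to product-distrib-*;
              sum-permute to product-permute; sum-cong-≋ to product-cong; sum-replicate to product-replicate;
              sum-replicate-zero to product-replicate-1)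
  open Relation.Binary.Reasoning.Setoid setoid

  ifZero : Carrier → Carrier → Carrier → Carrier
  ifZero z u v with z ≟ 0#
  ... | yes _ = u
  ... | no  _ = v

  ifZero-yes : ∀ {z u v} → z ≈ 0# → ifZero z u v ≈ u
  ifZero-yes {z} z≈0 with z ≟ 0#
  ... | yes _   = refl
  ... | no  z≉0 = contradiction z≈0 z≉0

  ifZero-no : ∀ {z u v} → ¬ (z ≈ 0#) → ifZero z u v ≈ v
  ifZero-no {z} z≉0 with z ≟ 0#
  ... | yes z≈0 = contradiction z≈0 z≉0
  ... | no  _   = refl

  product-≉0 : ∀ {m} (t : Fin m → Carrier) → (∀ i → ¬ (t i ≈ 0#)) → ¬ (product t ≈ 0#)
  product-≉0 {zero}  t t≉0 = λ 1≈0 → 0≉1 (sym 1≈0)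
  product-≉0 {suc m} t t≉0 = *-≉0 (t≉0 Fin.zero) (product-≉0 (t ∘ Fin.suc) (t≉0 ∘ Fin.suc))

  -- With 0 replaced by 1, a product over the whole carrier is the product of its nonzero elements.
  nonzero-part : Carrier → Carrier
  nonzero-part z = ifZero z 1# z

  nonzero-part-≉0 : ∀ z → ¬ (nonzero-part z ≈ 0#)
  nonzero-part-≉0 z with z ≟ 0#
  ... | yes _   = λ 1≈0 → 0≉1 (sym 1≈0)
  ... | no  z≉0 = z≉0

  nonzero-part-cong : ∀ {y z} → y ≈ z → nonzero-part y ≈ nonzero-part z
  nonzero-part-cong {y} {z} y≈z with z ≟ 0#
  ... | yes z≈0 = ifZero-yes (trans y≈z z≈0)
  ... | no  z≉0 = trans (ifZero-no (λ y≈0 → z≉0 (trans (sym y≈z) y≈0))) y≈z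

  nonzero-part-* : ∀ {x} → ¬ (x ≈ 0#) → ∀ z → nonzero-part (x * z) ≈ ifZero z 1# x * nonzero-part z
  nonzero-part-* {x} x≉0 z with z ≟ 0#
  ... | yes z≈0 = trans (ifZero-yes (trans (*-congˡ z≈0) (zeroʳ x))) (sym (*-identityˡ 1#))
  ... | no  z≉0 = ifZero-no (*-≉0 x≉0 z≉0)

  -- Multiplication by x permutes the nonzero elements, so their product absorbs the factors x.
  product-ifZero-1 : ∀ {x} → ¬ (x ≈ 0#) → product (λ i → ifZero (from i) 1# x) ≈ 1#
  product-ifZero-1 {x} x≉0 with x⁻¹ , xx⁻¹≈1 ← inverse x x≉0 =
    *-cancelˡ-≉0 (product-≉0 h (nonzero-part-≉0 ∘ from)) (begin
      product h * product k          ≈⟨ *-comm _ _ ⟩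
      product k * product h          ≈⟨ product-distrib-* k h ⟨
      product (λ i → k i * h i)      ≈⟨ product-cong h-scale ⟨
      product (h ∘ scale x)          ≈⟨ product-permute h scaling ⟨
      product h                      ≈⟨ *-identityʳ _ ⟨
      product h * 1#                 ∎)
    where
    h k : Fin N → Carrier
    h i = nonzero-part (from i)
    k i = ifZero (from i) 1# x

    x⁻¹x≈1 : x⁻¹ * x ≈ 1#
    x⁻¹x≈1 = trans (*-comm _ _) xx⁻¹≈1

    scale : Carrier → Fin N → Fin N
    scale y i = to (y * from i)

    scale-inverse : ∀ {y z} → y * z ≈ 1# → ∀ i → scale y (scale z i) ≡ i
    scale-inverse {y} {z} yz≈1 i = ≡.trans (to-cong (begin
      y * from (to (z * from i))  ≈⟨ *-congˡ (strictlyInverseʳ _) ⟩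
      y * (z * from i)            ≈⟨ *-assoc _ _ _ ⟨
      y * z * from i              ≈⟨ *-congʳ yz≈1 ⟩
      1# * from i                 ≈⟨ *-identityˡ _ ⟩
      from i                      ∎)) (strictlyInverseˡ i)

    scaling : Permutation′ N
    scaling = permutation (scale x) (scale x⁻¹) (scale-inverse xx⁻¹≈1) (scale-inverse x⁻¹x≈1)

    h-scale : ∀ i → h (scale x i) ≈ k i * h i
    h-scale i = trans (nonzero-part-cong (strictlyInverseʳ _)) (nonzero-part-* x≉0 (from i))

  product-indicator : ∀ {m} (i : Fin m) {x} (t : Fin m → Carrier) →
                      t i ≈ x → (∀ j → ¬ (j ≡ i) → t j ≈ 1#) → product t ≈ x
  product-indicator {suc m} i {x} t ti≈x tj≈1 = begin
    product t                                        ≈⟨ product-remove {i = i} t ⟩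
    t i * product (λ j → t (Fin.punchIn i j))        ≈⟨ *-cong ti≈x (product-cong (λ j → tj≈1 _ (Fin.punchInᵢ≢i i j))) ⟩
    x * product (replicate m 1#)                     ≈⟨ *-congˡ (product-replicate-1 m) ⟩
    x * 1#                                           ≈⟨ *-identityʳ x ⟩
    x                                                ∎

  -- Each of the N factors x splits into a part that is 1 at the element 0 and a part that is 1
  -- elsewhere. The first parts multiply to x^(N-1) = 1, the second to x.
  x^N≈x : ∀ x → x ^ N ≈ x
  x^N≈x x with x ≟ 0#
  ... | yes x≈0 = trans (^-congˡ N x≈0) (trans (0^ (to 0#)) (sym x≈0))
    where
    -- The index `to 0#` witnesses N > 0; an empty power of 0 would be 1.
    0^ : ∀ {m} → Fin m → 0# ^ m ≈ 0#
    0^ {suc m} _ = zeroˡ _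
  ... | no  x≉0 = begin
    x ^ N                                ≈⟨ product-replicate N ⟨
    product (replicate N x)              ≈⟨ product-cong (split ∘ from) ⟨
    product (λ i → k i * k₀ i)           ≈⟨ product-distrib-* k k₀ ⟩
    product k * product k₀               ≈⟨ *-cong (product-ifZero-1 x≉0) (product-indicator (to 0#) k₀ k₀-0 k₀-≢) ⟩
    1# * x                               ≈⟨ *-identityˡ x ⟩
    x                                    ∎
    where
    k k₀ : Fin N → Carrier
    k  i = ifZero (from i) 1# x
    k₀ i = ifZero (from i) x 1#

    split : ∀ z → ifZero z 1# x * ifZero z x 1# ≈ x
    split z with z ≟ 0#
    ... | yes _ = *-identityˡ x
    ... | no  _ = *-identityʳ x

    k₀-0 : k₀ (to 0#) ≈ x
    k₀-0 = ifZero-yes (strictlyInverseʳ 0#)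

    k₀-≢ : ∀ i → ¬ (i ≡ to 0#) → k₀ i ≈ 1#
    k₀-≢ i i≢ = ifZero-no (λ eq → i≢ (≡.trans (≡.sym (strictlyInverseˡ i)) (to-cong eq)))

-- Characteristic two and iterated Frobenius maps.

module _ {c ℓ : Level} (F : CommutativeRing c ℓ) (field′ : IsFieldCR F) where
  open CommutativeRing F
  open IsFieldCR field′
  open Power F
  open Algebra.Properties.Ring ring using (-1*x≈-x)
  open Algebra.Properties.Group +-group using (⁻¹-involutive)
  open Relation.Binary.Reasoning.Setoid setoid

  -- By Fermat, -1 = (-1)^(2^m) = 1.
  2^m⇒1+1≈0 : ∀ m → HasCardinality F (2 ^ℕ m) → HasCharTwo F
  2^m⇒1+1≈0 zero    card = contradiction (FiniteSetoid.to-injective F card (Fin1 _ _)) 0≉1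
    where
    Fin1 : ∀ (i j : Fin 1) → i ≡ j
    Fin1 Fin.zero Fin.zero = ≡.refl
  2^m⇒1+1≈0 (suc m) card = begin
    1# + 1#                        ≈⟨ +-congˡ (1^ (2 ^ℕ m)) ⟨
    1# + 1# ^ (2 ^ℕ m)             ≈⟨ +-congˡ (^-congˡ (2 ^ℕ m) -1²≈1) ⟨
    1# + ((- 1#) ^ 2) ^ (2 ^ℕ m)   ≈⟨ +-congˡ (^-assocʳ (- 1#) 2 (2 ^ℕ m)) ⟩
    1# + (- 1#) ^ (2 ^ℕ suc m)     ≈⟨ +-congˡ (Fermat.x^N≈x F field′ card (- 1#)) ⟩
    1# + - 1#                      ≈⟨ -‿inverseʳ 1# ⟩
    0#                             ∎
    where
    -1²≈1 : (- 1#) ^ 2 ≈ 1#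
    -1²≈1 = trans (x^2≈x*x (- 1#)) (trans (-1*x≈-x (- 1#)) (⁻¹-involutive 1#))

module Frobenius {c ℓ : Level} (F : CommutativeRing c ℓ)
  (1+1≈0 : HasCharTwo F) where
  open CommutativeRing F
  open Power F
  open CharTwo F 1+1≈0

  ^2^-endo : ∀ k → IsEndo F (_^ (2 ^ℕ k))
  ^2^-endo k = record
    { τ-cong = ^-congˡ (2 ^ℕ k)
    ; +-homo = +-homo k
    ; *-homo = λ x y → ^-distrib-* x y (2 ^ℕ k)
    ; 1-homo = 1^ (2 ^ℕ k)
    }
    where
    open Relation.Binary.Reasoning.Setoid setoid
    -- Squaring is additive here, so one squaring is split off and the induction hypothesis is
    -- applied to x² and y².
    +-homo : ∀ k x y → (x + y) ^ (2 ^ℕ k) ≈ x ^ (2 ^ℕ k) + y ^ (2 ^ℕ k)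
    +-homo zero    x y = trans (*-identityʳ _) (sym (+-cong (*-identityʳ x) (*-identityʳ y)))
    +-homo (suc k) x y = begin
      (x + y) ^ (2 *ℕ m)                ≈⟨ ^-assocʳ _ 2 m ⟨
      ((x + y) ^ 2) ^ m                 ≈⟨ ^-congˡ m (solve 2 (λ x y →
                                             (x :+ y) :* ((x :+ y) :* con true) :=
                                             x :* (x :* con true) :+ y :* (y :* con true)) refl x y) ⟩
      (x ^ 2 + y ^ 2) ^ m               ≈⟨ +-homo k _ _ ⟩
      (x ^ 2) ^ m + (y ^ 2) ^ m         ≈⟨ +-cong (^-assocʳ x 2 m) (^-assocʳ y 2 m) ⟩
      x ^ (2 *ℕ m) + y ^ (2 *ℕ m)       ∎
      where m = 2 ^ℕ k

  -- Turns subfield conditions on powers into iterates of the q-Frobenius; for a numeral `k` the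
  -- fold computes to `σ²`, `σ³` and so on.
  ^2^-* : ∀ k n x → x ^ (2 ^ℕ (k *ℕ n)) ≈ fold x (_^ (2 ^ℕ n)) k
  ^2^-* zero    n x = *-identityʳ x
  ^2^-* (suc k) n x = begin
    x ^ (2 ^ℕ (n +ℕ k *ℕ n))              ≈⟨ ^-congʳ x (≡.cong (2 ^ℕ_) (ℕ.+-comm n (k *ℕ n))) ⟩
    x ^ (2 ^ℕ (k *ℕ n +ℕ n))              ≈⟨ ^-congʳ x (ℕ.^-distribˡ-+-* 2 (k *ℕ n) n) ⟩
    x ^ (2 ^ℕ (k *ℕ n) *ℕ 2 ^ℕ n)         ≈⟨ ^-assocʳ x (2 ^ℕ (k *ℕ n)) (2 ^ℕ n) ⟨
    (x ^ (2 ^ℕ (k *ℕ n))) ^ (2 ^ℕ n)      ≈⟨ ^-congˡ (2 ^ℕ n) (^2^-* k n x) ⟩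
    fold x (_^ (2 ^ℕ n)) (suc k)          ∎
    where open Relation.Binary.Reasoning.Setoid setoid

-- Binary encoding of coefficient vectors.

bits : ∀ d → Fin (2 ^ℕ d) → Fin d → Bool
bits d i j = Inverse.to Fin.2↔Bool (Fin.finToFun {2} {d} i j)

fromBits : ∀ {d} → (Fin d → Bool) → Fin (2 ^ℕ d)
fromBits k = Fin.funToFin (Inverse.from Fin.2↔Bool ∘ k)

bits-fromBits : ∀ {d} (k : Fin d → Bool) j → bits d (fromBits k) j ≡ k j
bits-fromBits k j =
  ≡.trans (≡.cong (Inverse.to Fin.2↔Bool) (Fin.finToFun-funToFin _ j)) (Inverse.strictlyInverseˡ Fin.2↔Bool (k j))

-- Takes the place of function extensionality when coefficient vectors agree only pointwise.
funToFin-cong : ∀ {m n} {f g : Fin m → Fin n} → (∀ l → f l ≡ g l) → Fin.funToFin f ≡ Fin.funToFin g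
funToFin-cong {zero}  eq = ≡.refl
funToFin-cong {suc m} eq = ≡.cong₂ Fin.combine (eq Fin.zero) (funToFin-cong (eq ∘ Fin.suc))

fromBits-bits : ∀ d (i : Fin (2 ^ℕ d)) → fromBits (bits d i) ≡ i
fromBits-bits d i = ≡.trans (funToFin-cong (λ l → Inverse.strictlyInverseʳ Fin.2↔Bool (Fin.finToFun {2} {d} i l)))
  (Fin.funToFin-finToFin {d} {2} i)

bits-injective : ∀ d {i j : Fin (2 ^ℕ d)} → (∀ l → bits d i l ≡ bits d j l) → i ≡ j
bits-injective d {i} {j} eq = ≡.trans (≡.sym (fromBits-bits d i))
  (≡.trans (funToFin-cong (≡.cong (Inverse.from Fin.2↔Bool) ∘ eq)) (fromBits-bits d j))

2^-cancel-≤ : ∀ {m n} → 2 ^ℕ m ≤ 2 ^ℕ n → m ≤ n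
2^-cancel-≤ {m} {n} le = ℕ.≮⇒≥ (λ n<m → ℕ.<⇒≱ (ℕ.^-monoʳ-< 2 (ℕ.n<1+n 1) n<m) le)

2^-injective : ∀ {m n} → 2 ^ℕ m ≡ 2 ^ℕ n → m ≡ n
2^-injective eq = ℕ.≤-antisym (2^-cancel-≤ (ℕ.≤-reflexive eq)) (2^-cancel-≤ (ℕ.≤-reflexive (≡.sym eq)))

-- Linear combinations and dimension over F₂.

module F₂Span {c ℓ : Level} (F : CommutativeRing c ℓ)
  (1+1≈0 : HasCharTwo F) where
  open CommutativeRing F
  open FieldNotions F
  open CharTwo F 1+1≈0
  open Relation.Binary.Reasoning.Setoid setoid

  -- Coefficients in F₂ add by `xor`; where both are `true`, the two copies of the vector cancel.
  comb-xor : ∀ {d} (e : Fin d → Carrier) k k′ → comb e (λ i → k i xor k′ i) ≈ comb e k + comb e k′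
  comb-xor {zero}  e k k′ = sym (+-identityʳ 0#)
  comb-xor {suc d} e k k′ with k Fin.zero | k′ Fin.zero | comb-xor (e ∘ Fin.suc) (k ∘ Fin.suc) (k′ ∘ Fin.suc)
  ... | true  | true  | ih = trans (+-congˡ ih)
    (solve 3 (λ x p q → con false :+ (p :+ q) := (x :+ p) :+ (x :+ q)) refl _ _ _)
  ... | true  | false | ih = trans (+-congˡ ih)
    (solve 3 (λ x p q → x :+ (p :+ q) := (x :+ p) :+ (con false :+ q)) refl _ _ _)
  ... | false | true  | ih = trans (+-congˡ ih)
    (solve 3 (λ x p q → x :+ (p :+ q) := (con false :+ p) :+ (x :+ q)) refl _ _ _)
  ... | false | false | ih = trans (+-congˡ ih)
    (solve 2 (λ p q → con false :+ (p :+ q) := (con false :+ p) :+ (con false :+ q)) refl _ _)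

  comb-cong : ∀ {d} (e : Fin d → Carrier) {k k′} → (∀ i → k i ≡ k′ i) → comb e k ≈ comb e k′
  comb-cong {zero}  e eq = refl
  comb-cong {suc d} e eq rewrite eq Fin.zero = +-congˡ (comb-cong (e ∘ Fin.suc) (eq ∘ Fin.suc))

  comb-additive : ∀ {g : Carrier → Carrier} → g 0# ≈ 0# → (∀ x y → g (x + y) ≈ g x + g y) →
                  ∀ {d} (e : Fin d → Carrier) k → comb (g ∘ e) k ≈ g (comb e k)
  comb-additive g-0 g-+ {zero}  e k = sym g-0
  comb-additive g-0 g-+ {suc d} e k with k Fin.zero | comb-additive g-0 g-+ (e ∘ Fin.suc) (k ∘ Fin.suc)
  ... | true  | ih = sym (trans (g-+ _ _) (+-congˡ (sym ih)))
  ... | false | ih = sym (trans (g-+ _ _) (+-cong g-0 (sym ih)))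

  Independent : ∀ {d} → (Fin d → Carrier) → Set ℓ
  Independent {d} e = ∀ (k : Fin d → Bool) → comb e k ≈ 0# → ∀ i → k i ≡ false

  comb-injective : ∀ {d} {e : Fin d → Carrier} → Independent e → ∀ {k k′} → comb e k ≈ comb e k′ → ∀ i → k i ≡ k′ i
  comb-injective {e = e} ind {k} {k′} eq i
    with k i | k′ i | ind (λ i → k i xor k′ i) (trans (comb-xor e k k′) (x≈y⇒x+y≈0 eq)) i
  ... | true  | true  | _ = ≡.refl
  ... | false | false | _ = ≡.refl

  comb-bits-injective : ∀ {d} {e : Fin d → Carrier} → Independent e →
                        ∀ {i j} → comb e (bits d i) ≈ comb e (bits d j) → i ≡ j
  comb-bits-injective {d} ind eq = bits-injective d (comb-injective ind eq)

  -- `g` induces an additive bijection from `S` to `T`, so it carries a basis to a basis.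
  hasF2Dim-image : ∀ {p q} {S : Carrier → Set p} {T : Carrier → Set q} {g : Carrier → Carrier} →
    (∀ {x y} → x ≈ y → g x ≈ g y) → g 0# ≈ 0# → (∀ x y → g (x + y) ≈ g x + g y) →
    (∀ {x} → S x → g x ≈ 0# → x ≈ 0#) →
    (∀ {x y} → S x → y ≈ g x → T y) → (∀ {y} → T y → ∃ λ x → S x × y ≈ g x) →
    ∀ {d} → HasF2Dim S d → HasF2Dim T d
  hasF2Dim-image {g = g} g-cong g-0 g-+ g-ker S⇒T T⇒S (e , e-closed , e-span , ind) =
    g ∘ e ,
    (λ k → S⇒T (e-closed k) (comb-additive g-0 g-+ e k)) ,
    (λ y Ty → let x , Sx , y≈gx = T⇒S Ty
                  k , x≈comb = e-span x Sx
              in k , trans y≈gx (trans (g-cong x≈comb) (sym (comb-additive g-0 g-+ e k)))) ,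
    λ k eq → ind k (g-ker (e-closed k) (trans (sym (comb-additive g-0 g-+ e k)) eq))

  -- Bases of subspaces by exhaustive search.

  module Basis {M : ℕ} (card : HasCardinality F (2 ^ℕ M)) where
    open Inverse card using (to; from; strictlyInverseʳ)
    open FiniteSetoid F card

    -- The 2^d combinations are distinct among 2^M elements.
    independent⇒≤ : ∀ {d} {e : Fin d → Carrier} → Independent e → d ≤ M
    independent⇒≤ {d} {e} ind = 2^-cancel-≤ (Fin.injective⇒≤ {f = λ i → to (comb e (bits d i))}
      (λ eq → comb-bits-injective ind (to-injective eq)))

    InSpan : ∀ {d} → (Fin d → Carrier) → Carrier → Set ℓ
    InSpan e y = ∃ λ k → y ≈ comb e k

    cons : ∀ {a} {A : Set a} {d} → A → (Fin d → A) → Fin (suc d) → A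
    cons x k Fin.zero    = x
    cons x k (Fin.suc i) = k i

    -- According to the leading coefficient, either `y` or `e Fin.zero + y` must lie in the span of
    -- the remaining vectors.
    inSpan? : ∀ {d} (e : Fin d → Carrier) y → Dec (InSpan e y)
    inSpan? {zero} e y with y ≟ 0#
    ... | yes y≈0 = yes ((λ ()) , y≈0)
    ... | no  y≉0 = no (λ (_ , y≈0) → y≉0 y≈0)
    inSpan? {suc d} e y with inSpan? (e ∘ Fin.suc) y | inSpan? (e ∘ Fin.suc) (e Fin.zero + y)
    ... | yes (k , eq) | _            = yes (cons false k , trans eq (sym (+-identityˡ _)))
    ... | no _         | yes (k , eq) = yes (cons true k ,
            trans (solve 2 (λ a y → y := a :+ (a :+ y)) refl (e Fin.zero) y) (+-congˡ eq))
    ... | no out       | no out′      = no not-in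
      where
      not-in : ¬ InSpan e y
      not-in (k , eq) with k Fin.zero
      ... | true  = out′ (k ∘ Fin.suc , trans (+-congˡ eq) (solve 2 (λ a z → a :+ (a :+ z) := z) refl (e Fin.zero) _))
      ... | false = out  (k ∘ Fin.suc , trans eq (+-identityˡ _))

    -- A relation involving `y` could be solved for `y` in the span of `e`.
    cons-independent : ∀ {d} {e : Fin d → Carrier} {y} → Independent e → ¬ InSpan e y → Independent (cons y e)
    cons-independent ind out k eq i with k Fin.zero in k0
    ... | true = contradiction (k ∘ Fin.suc , x+y≈0⇒x≈y eq) out
    cons-independent ind out k eq Fin.zero    | false = k0
    cons-independent ind out k eq (Fin.suc i) | false = ind (k ∘ Fin.suc) (trans (sym (+-identityˡ _)) eq) i

    module _ {p} {S : Carrier → Set p} (S? : ∀ x → Dec (S x)) (S-resp : ∀ {x y} → x ≈ y → S x → S y)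
             (S-0 : S 0#) (S-+ : ∀ {x y} → S x → S y → S (x + y)) where

      comb-closed : ∀ {d} {e : Fin d → Carrier} → (∀ i → S (e i)) → ∀ k → S (comb e k)
      comb-closed {zero}  Se k = S-0
      comb-closed {suc d} Se k with k Fin.zero
      ... | true  = S-+ (Se Fin.zero) (comb-closed (Se ∘ Fin.suc) (k ∘ Fin.suc))
      ... | false = S-+ S-0 (comb-closed (Se ∘ Fin.suc) (k ∘ Fin.suc))

      -- Elements of `S` outside the span are added until none is left. `t` is fuel: since d + t = M
      -- + 1, exhausting it would yield M + 1 independent vectors, one above the bound.
      extend-to-basis : ∀ t {d} (e : Fin d → Carrier) → (∀ i → S (e i)) → Independent e → d +ℕ t ≡ suc M →
                        Σ ℕ (HasF2Dim S)
      extend-to-basis zero {d} e Se ind d+0≡1+M =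
        contradiction (ℕ.≤-trans (ℕ.≤-reflexive (≡.trans (≡.sym d+0≡1+M) (ℕ.+-identityʳ d))) (independent⇒≤ ind))
          (ℕ.<⇒≱ (ℕ.n<1+n M))
      extend-to-basis (suc t) {d} e Se ind d+1+t≡1+M
        with Fin.any? (λ i → S? (from i) ×-dec ¬? (inSpan? e (from i)))
      ... | yes (i , Sy , out) = extend-to-basis t (cons (from i) e)
              (λ { Fin.zero → Sy ; (Fin.suc j) → Se j }) (cons-independent ind out)
              (≡.trans (≡.sym (ℕ.+-suc d t)) d+1+t≡1+M)
      ... | no none = d , e , comb-closed Se , spanning , ind
        where
        spanning : ∀ y → S y → InSpan e y
        spanning y Sy with inSpan? e (from (to y))
        ... | yes (k , eq) = k , trans (sym (strictlyInverseʳ y)) eq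
        ... | no out = contradiction (to y , S-resp (sym (strictlyInverseʳ y)) Sy , out) none

      basis : Σ ℕ (HasF2Dim S)
      basis = extend-to-basis (suc M) {0} (λ ()) (λ ()) (λ _ _ ()) ≡.refl

    -- F ≅ S × S, so that 2^M = 2^d · 2^d.
    half-dimension : ∀ {p} {S : Carrier → Set p} {d} → HasF2Dim S d → ∀ ω →
      (∀ {u v u′ v′} → S u → S v → S u′ → S v′ → u + v * ω ≈ u′ + v′ * ω → u ≈ u′ × v ≈ v′) →
      (∀ x → Σ Carrier λ u → Σ Carrier λ v → S u × S v × x ≈ u + v * ω) →
      d +ℕ d ≡ M
    half-dimension {S = S} {d} (e , e-closed , e-span , ind) ω unique exist =
      -- `decode` is injective by uniqueness of coordinates, `encode` because coordinates determine
      -- the element.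
      2^-injective (≡.trans (ℕ.^-distribˡ-+-* 2 d d) (Fin.cantor-schröder-bernstein decode-injective encode-injective))
      where
      point : Fin (2 ^ℕ d) → Carrier
      point i = comb e (bits d i)

      decode : Fin (2 ^ℕ d *ℕ 2 ^ℕ d) → Fin (2 ^ℕ M)
      decode i with j , l ← Fin.remQuot {2 ^ℕ d} (2 ^ℕ d) i = to (point j + point l * ω)

      decode-injective : ∀ {i i′} → decode i ≡ decode i′ → i ≡ i′
      decode-injective {i} {i′} eq
        with u , v ← unique (e-closed _) (e-closed _) (e-closed _) (e-closed _) (to-injective eq) =
        ≡.trans (≡.sym (Fin.combine-remQuot {2 ^ℕ d} (2 ^ℕ d) i))
          (≡.trans (≡.cong₂ Fin.combine (comb-bits-injective ind u) (comb-bits-injective ind v))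
            (Fin.combine-remQuot {2 ^ℕ d} (2 ^ℕ d) i′))

      index : ∀ {y} → S y → Fin (2 ^ℕ d)
      index {y} Sy = fromBits (proj₁ (e-span y Sy))

      point-index : ∀ {y} (Sy : S y) → point (index Sy) ≈ y
      point-index {y} Sy = trans (comb-cong e (bits-fromBits _)) (sym (proj₂ (e-span y Sy)))

      index-injective : ∀ {y z} (Sy : S y) (Sz : S z) → index Sy ≡ index Sz → y ≈ z
      index-injective Sy Sz eq = trans (sym (point-index Sy)) (trans (reflexive (≡.cong point eq)) (point-index Sz))

      encode : Fin (2 ^ℕ M) → Fin (2 ^ℕ d *ℕ 2 ^ℕ d)
      encode i with u , v , Su , Sv , _ ← exist (from i) = Fin.combine (index Su) (index Sv)

      encode-injective : ∀ {i i′} → encode i ≡ encode i′ → i ≡ i′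
      encode-injective {i} {i′} eq
        with u , v , Su , Sv , x≈ ← exist (from i) | u′ , v′ , Su′ , Sv′ , x′≈ ← exist (from i′)
        with eq₁ , eq₂ ← Fin.combine-injective (index Su) (index Sv) (index Su′) (index Sv′) eq =
        ≡.trans (≡.sym (Inverse.strictlyInverseˡ card i)) (≡.trans (Inverse.to-cong card (begin
          from i       ≈⟨ x≈ ⟩
          u + v * ω    ≈⟨ +-cong (index-injective Su Su′ eq₁) (*-congʳ (index-injective Sv Sv′ eq₂)) ⟩
          u′ + v′ * ω  ≈⟨ x′≈ ⟨
          from i′      ∎)) (Inverse.strictlyInverseˡ card i′))

-- The scattered linear set of rank 3n.

theorem2p10 : {c ℓ : Level} (n : ℕ) → 1 < n →
    (F : CommutativeRing c ℓ) → IsFieldCR F → HasCardinality F (2 ^ℕ (6 *ℕ n)) →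
    let open CommutativeRing F
        open FieldNotions F
    in (ω b : Carrier) →
       InSub (2 *ℕ n) ω → ¬ InSub n ω →
       InSub* (3 *ℕ n) b → ¬ (norm3 n b ≈ 1#) →
       (∀ x → InSub* (3 *ℕ n) x → ¬ InSub n (x + b * pow x (2 ^ℕ (2 *ℕ n +ℕ 1) ∸ 1))) →
       ScatteredOfRank n
         (λ y → Σ Carrier λ x → InSub (3 *ℕ n) x × y ≈ (pow x 2 + b * pow x (2 ^ℕ (2 *ℕ n +ℕ 1)) + x * ω))
         (3 *ℕ n)
theorem2p10 n 1<n F field′ card ω b ω∈𝔽q² ω∉𝔽q (b∈𝔽q³ , _) norm3≉1 not-in-𝔽q =
  U-dimension , one-dimensional
  where
  open CommutativeRing F
  open FieldNotions F
  open FieldLemmas F field′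
  open Power F
  open Relation.Binary.Reasoning.Setoid setoid

  1+1≈0 : HasCharTwo F
  1+1≈0 = 2^m⇒1+1≈0 F field′ (6 *ℕ n) card

  open CharTwo F 1+1≈0 using (solve; _:=_; _:+_; _:*_)
  open FiniteSetoid F card using (_≟_)
  open Frobenius F 1+1≈0
  open F₂Span F 1+1≈0
  open Basis {6 *ℕ n} card

  σ : Carrier → Carrier
  σ x = x ^ (2 ^ℕ n)

  open Semilinear F field′ card 1+1≈0 σ (^2^-endo n) b

  U : Carrier → Set _
  U y = Σ Carrier λ x → InSub (3 *ℕ n) x × y ≈ (pow x 2 + b * pow x (2 ^ℕ (2 *ℕ n +ℕ 1)) + x * ω)

  pow-2n : ∀ x → pow x (2 ^ℕ (2 *ℕ n)) ≈ σ² x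
  pow-2n x = trans (pow≈^ x (2 ^ℕ (2 *ℕ n))) (^2^-* 2 n x)

  pow-3n : ∀ x → pow x (2 ^ℕ (3 *ℕ n)) ≈ σ³ x
  pow-3n x = trans (pow≈^ x (2 ^ℕ (3 *ℕ n))) (^2^-* 3 n x)

  InSub⇒Fix³ : ∀ {x} → InSub (3 *ℕ n) x → Fix³ x
  InSub⇒Fix³ {x} = trans (sym (pow-3n x))

  Fix³⇒InSub : ∀ {x} → Fix³ x → InSub (3 *ℕ n) x
  Fix³⇒InSub {x} = trans (pow-3n x)

  σ⁶≈id : ∀ x → σ³ (σ³ x) ≈ x
  σ⁶≈id x = trans (sym (^2^-* 6 n x)) (Fermat.x^N≈x F field′ card x)

  Kb : Fix³ b
  Kb = InSub⇒Fix³ b∈𝔽q³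

  ω-Fix² : σ² ω ≈ ω
  ω-Fix² = trans (sym (pow-2n ω)) ω∈𝔽q²

  ω-¬Fix : ¬ Fix ω
  ω-¬Fix σω≈ω = ω∉𝔽q (trans (pow≈^ ω (2 ^ℕ n)) σω≈ω)

  norm≉1 : ¬ (b * σ b * σ² b ≈ 1#)
  norm≉1 eq = norm3≉1 (begin
    pow b (1 +ℕ 2 ^ℕ n +ℕ 2 ^ℕ (2 *ℕ n))        ≈⟨ pow≈^ b (1 +ℕ 2 ^ℕ n +ℕ 2 ^ℕ (2 *ℕ n)) ⟩
    b ^ (1 +ℕ 2 ^ℕ n +ℕ 2 ^ℕ (2 *ℕ n))          ≈⟨ ^-homo-* b (1 +ℕ 2 ^ℕ n) (2 ^ℕ (2 *ℕ n)) ⟩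
    b ^ (1 +ℕ 2 ^ℕ n) * b ^ (2 ^ℕ (2 *ℕ n))     ≈⟨ *-congˡ (^2^-* 2 n b) ⟩
    b * σ b * σ² b                              ≈⟨ eq ⟩
    1#                                          ∎)

  pow-2n+1 : ∀ x → pow x (2 ^ℕ (2 *ℕ n +ℕ 1)) ≈ σ² x * σ² x
  pow-2n+1 x = begin
    pow x (2 ^ℕ (2 *ℕ n +ℕ 1))    ≈⟨ pow≈^ x (2 ^ℕ (2 *ℕ n +ℕ 1)) ⟩
    x ^ (2 ^ℕ (2 *ℕ n +ℕ 1))      ≈⟨ ^-congʳ x (ℕ.^-distribˡ-+-* 2 (2 *ℕ n) 1) ⟩
    x ^ (2 ^ℕ (2 *ℕ n) *ℕ 2)      ≈⟨ ^-assocʳ x (2 ^ℕ (2 *ℕ n)) 2 ⟨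
    (x ^ (2 ^ℕ (2 *ℕ n))) ^ 2     ≈⟨ ^-congˡ 2 (^2^-* 2 n x) ⟩
    σ² x ^ 2                      ≈⟨ x^2≈x*x (σ² x) ⟩
    σ² x * σ² x                   ∎

  f-as-pow : ∀ x → pow x 2 + b * pow x (2 ^ℕ (2 *ℕ n +ℕ 1)) ≈ f x
  f-as-pow x = +-cong (x^2≈x*x x) (*-congˡ (pow-2n+1 x))

  -- f z / z equals z + b z^(2^(2n+1) - 1), which the hypothesis keeps out of F_q.
  no-eigenvector : ∀ {z} → Fix³ z → ¬ (z ≈ 0#) → ¬ (f z * σ z ≈ z * σ (f z))
  no-eigenvector {z} Kz z≉0 eq = not-in-𝔽q z (Fix³⇒InSub Kz , z≉0) (trans (pow≈^ q (2 ^ℕ n)) (sym q≈σq))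
    where
    m = 2 ^ℕ (2 *ℕ n +ℕ 1)
    -- This `q` is the quotient f z / z, not the field order 2ⁿ.
    q = z + b * pow z (m ∸ 1)

    zq≈fz : z * q ≈ f z
    zq≈fz = begin
      z * q                          ≈⟨ solve 3 (λ z b t → z :* (z :+ b :* t) := z :* z :+ b :* (z :* t)) refl z b _ ⟩
      z * z + b * pow z (suc (m ∸ 1))
        -- A power of 2 is positive, so the truncated subtraction is exact.
        ≈⟨ +-congˡ (*-congˡ (reflexive (≡.cong (pow z) (ℕ.m+[n∸m]≡n (ℕ.m^n>0 2 (2 *ℕ n +ℕ 1)))))) ⟩
      z * z + b * pow z m            ≈⟨ +-congˡ (*-congˡ (pow-2n+1 z)) ⟩
      f z                            ∎

    q≈σq : q ≈ σ q
    q≈σq = *-cancelˡ-≉0 (*-≉0 z≉0 (σ-≉0 Kz z≉0)) (begin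
      z * σ z * q      ≈⟨ solve 3 (λ z s q → z :* s :* q := z :* q :* s) refl z (σ z) q ⟩
      z * q * σ z      ≈⟨ *-congʳ zq≈fz ⟩
      f z * σ z        ≈⟨ eq ⟩
      z * σ (f z)      ≈⟨ *-congˡ (τ-cong zq≈fz) ⟨
      z * σ (z * q)    ≈⟨ *-congˡ (*-homo z q) ⟩
      z * (σ z * σ q)  ≈⟨ *-assoc z (σ z) (σ q) ⟨
      z * σ z * σ q    ∎)

  h : Carrier → Carrier
  h x = f x + x * ω

  h-as-pow : ∀ x → h x ≈ pow x 2 + b * pow x (2 ^ℕ (2 *ℕ n +ℕ 1)) + x * ω
  h-as-pow x = +-congʳ (sym (f-as-pow x))

  h-cong : ∀ {x y} → x ≈ y → h x ≈ h y
  h-cong x≈y = +-cong (f-cong x≈y) (*-congʳ x≈y)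

  h-0 : h 0# ≈ 0#
  h-0 = trans (+-cong f-0 (zeroˡ ω)) (+-identityʳ 0#)

  h-+ : ∀ x y → h (x + y) ≈ h x + h y
  h-+ x y = trans (+-congʳ (f-+ x y))
    (solve 5 (λ p q x y w → (p :+ q) :+ (x :+ y) :* w := (p :+ x :* w) :+ (q :+ y :* w)) refl (f x) (f y) x y ω)

  -- `basis` yields some dimension d, and unique coordinates over 1 and ω give 2d = 6n.
  K-dimension : HasF2Dim Fix³ (3 *ℕ n)
  K-dimension with d , dim-d ← basis (λ x → σ³ x ≟ x) 𝔽q³.fixed-resp 𝔽q³.0-homo 𝔽q³.fixed-+ =
    ≡.subst (HasF2Dim Fix³) (ℕ.*-cancelˡ-≡ d (3 *ℕ n) 2 (≡.trans (double d) (≡.trans d+d≡6n (6n n)))) dim-d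
    where
    d+d≡6n : d +ℕ d ≡ 6 *ℕ n
    d+d≡6n = half-dimension dim-d ω (coordinates-unique ω-Fix² ω-¬Fix) (coordinates-exist ω-Fix² ω-¬Fix σ⁶≈id)
    double : ∀ d → 2 *ℕ d ≡ d +ℕ d
    double = solve-∀
    6n : ∀ n → 6 *ℕ n ≡ 2 *ℕ (3 *ℕ n)
    6n = solve-∀

  -- U is the image of K under `h`, injective because `x` is the ω-coordinate of `h x`.
  U-dimension : HasF2Dim U (3 *ℕ n)
  U-dimension = hasF2Dim-image h-cong h-0 h-+
    (λ Kx hx≈0 → proj₂ (coordinates-0 ω-Fix² ω-¬Fix (f-Fix³ Kb Kx) Kx hx≈0))
    (λ {x} Kx y≈ → x , Fix³⇒InSub Kx , trans y≈ (h-as-pow x))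
    (λ (x , x∈𝔽q³ , y≈) → x , InSub⇒Fix³ x∈𝔽q³ , trans y≈ (sym (h-as-pow x)))
    K-dimension

  -- `v` alone is a basis: `f-ω-scattered` leaves only the multipliers 0 and 1, which are the two
  -- Boolean coefficients.
  one-dimensional : ∀ v → U v → ¬ (v ≈ 0#) →
    HasF2Dim (λ y → U y × Σ Carrier (λ λ′ → InSub (2 *ℕ n) λ′ × y ≈ λ′ * v)) 1
  one-dimensional v (y , y∈𝔽q³ , v≈) v≉0 = (λ _ → v) , closed , spanning , independent
    where
    v≈hy : v ≈ h y
    v≈hy = trans v≈ (sym (h-as-pow y))

    y≉0 : ¬ (y ≈ 0#)
    y≉0 y≈0 = v≉0 (trans v≈hy (trans (h-cong y≈0) h-0))

    closed : ∀ k → U (comb (λ _ → v) k) × Σ Carrier (λ λ′ → InSub (2 *ℕ n) λ′ × comb (λ _ → v) k ≈ λ′ * v)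
    closed k with k Fin.zero
    ... | true  = (y , y∈𝔽q³ , trans (+-identityʳ v) v≈)
                , 1# , trans (pow≈^ 1# (2 ^ℕ (2 *ℕ n))) (1^ (2 ^ℕ (2 *ℕ n))) , trans (+-identityʳ v) (sym (*-identityˡ v))
    ... | false = (0# , Fix³⇒InSub 𝔽q³.0-homo , trans (+-identityʳ 0#) (trans (sym h-0) (h-as-pow 0#)))
                , 0# , trans (pow-2n 0#) (trans (τ-cong 𝔽q.0-homo) 𝔽q.0-homo) , trans (+-identityʳ 0#) (sym (zeroˡ v))

    spanning : ∀ z → U z × Σ Carrier (λ λ′ → InSub (2 *ℕ n) λ′ × z ≈ λ′ * v) →
               Σ (Fin 1 → Bool) λ k → z ≈ comb (λ _ → v) k
    spanning z ((x , x∈𝔽q³ , z≈) , λ′ , λ′∈𝔽q² , z≈λ′v)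
      with f-ω-scattered ω-Fix² ω-¬Fix Kb norm≉1 no-eigenvector
             (InSub⇒Fix³ x∈𝔽q³) (InSub⇒Fix³ y∈𝔽q³) y≉0 (trans (sym (pow-2n λ′)) λ′∈𝔽q²)
             (trans (h-as-pow x) (trans (sym z≈) (trans z≈λ′v (*-congˡ v≈hy))))
    ... | inj₁ λ′≈0 = (λ _ → false) , trans z≈λ′v (trans (*-congʳ λ′≈0) (trans (zeroˡ v) (sym (+-identityʳ 0#))))
    ... | inj₂ λ′≈1 = (λ _ → true)  , trans z≈λ′v (trans (*-congʳ λ′≈1) (trans (*-identityˡ v) (sym (+-identityʳ v))))

    independent : ∀ k → comb (λ _ → v) k ≈ 0# → ∀ i → k i ≡ false
    independent k eq Fin.zero with k Fin.zero
    ... | true  = contradiction (trans (sym (+-identityʳ v)) eq) v≉0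
    ... | false = ≡.refl
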